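{- Let $p,q,r$ be pairwise distinct primes with $p<q$ and $p<r$, and let $A=\max_n |a_{pqr}(n)|$. Let $q',r'\in\{1,\dots,p-1\}$ be the inverses of $q$ and $r$ modulo $p$, let $\alpha=\min\{q',r',p-q',p-r'\}$, let $\beta$ be the unique integer with $0<\beta<p$ and $\alpha\beta qr\equiv 1\pmod p$, and put $\beta^*=\min\{\beta,p-\beta\}$. Then $$A\le \min\{2\alpha+\beta^*,\;p-\beta^*\}.$$
   Context: $\Phi_{pqr}(x)=\prod_{0<k<pqr,\ \gcd(k,pqr)=1}(x-\zeta^k)$, where $\zeta$ is a primitive $pqr$-th root of unity, is the ternary cyclotomic polynomial; $a_{pqr}(n)$ denotes its coefficient of $x^n$ (zero for $n$ outside $[0,\deg\Phi_{pqr}]$). -}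

module Defs where

open import Algebra.Apartness.Bundles using (HeytingField; HeytingCommutativeRing)
open import Algebra.Bundles using (CommutativeRing)
open import Data.Integer.Base using (ℤ; +_; -[1+_])
open import Data.List.Base using (List; []; _∷_; map; filter; foldr; upTo)
open import Data.Nat.Base using (ℕ; zero; suc; _<_; _≤_; ∣_-_∣)
open import Data.Nat.Divisibility using (_∣_)
open import Data.Nat.GCD using (gcd)
open import Data.Nat.Properties using (_≟_; _<?_)
open import Data.Product.Base using (_×_; ∃)
open import Level using (Level)
open import Relation.Binary.PropositionalEquality using (_≡_)
open import Relation.Nullary.Decidable using (_×-dec_)
open import Relation.Nullary.Negation using (¬_)
import Algebra.Properties.Semiring.Exp as Exp
import Algebra.Properties.Semiring.Mult as Mult

infix 4 _≡_mod_

_≡_mod_ : ℕ → ℕ → ℕ → Set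
a ≡ b mod m = m ∣ ∣ a - b ∣

IsMaximum : (ℕ → ℕ) → ℕ → Set
IsMaximum f M = (∃ λ n → f n ≡ M) × (∀ n → f n ≤ M)

-- The complex numbers enter only as a field of characteristic zero containing
-- a primitive root of unity. Heyting fields cover both discrete fields and
-- fields such as ℂ whose equality is not decidable.
module Cyclotomic {c ℓ₁ ℓ₂ : Level} (K : HeytingField c ℓ₁ ℓ₂) where

  open HeytingField K using
    (Carrier; _≈_; _+_; _*_; -_; 0#; 1#; heytingCommutativeRing)
  open CommutativeRing
    (HeytingCommutativeRing.commutativeRing heytingCommutativeRing)
    using (semiring)
  open Exp semiring using (_^_)
  open Mult semiring using () renaming (_×_ to _·_)

  CharacteristicZero : Set ℓ₁
  CharacteristicZero = ∀ n → 0 < n → ¬ (n · 1# ≈ 0#)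

  fromℤ : ℤ → Carrier
  fromℤ (+ n)    = n · 1#
  fromℤ -[1+ n ] = - (suc n · 1#)

  IsPrimitiveRoot : ℕ → Carrier → Set ℓ₁
  IsPrimitiveRoot n ζ =
    (ζ ^ n ≈ 1#) × (∀ k → 0 < k → k < n → ¬ (ζ ^ k ≈ 1#))

  -- Coefficient lists, constant term first; trailing zeros are allowed.
  Poly : Set c
  Poly = List Carrier

  coeff : Poly → ℕ → Carrier
  coeff []      _       = 0#
  coeff (a ∷ f) zero    = a
  coeff (a ∷ f) (suc n) = coeff f n

  infixl 6 _+ᴾ_
  infixl 7 _*ᴾ_

  _+ᴾ_ : Poly → Poly → Poly
  []      +ᴾ g       = g
  (a ∷ f) +ᴾ []      = a ∷ f
  (a ∷ f) +ᴾ (b ∷ g) = (a + b) ∷ (f +ᴾ g)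

  _*ᴾ_ : Poly → Poly → Poly
  []      *ᴾ g = []
  (a ∷ f) *ᴾ g = map (a *_) g +ᴾ (0# ∷ (f *ᴾ g))

  productᴾ : List Poly → Poly
  productᴾ = foldr _*ᴾ_ (1# ∷ [])

  X-_ : Carrier → Poly
  X- a = (- a) ∷ 1# ∷ []

  units : ℕ → List ℕ
  units n = filter (λ k → (0 <? k) ×-dec (gcd k n ≟ 1)) (upTo n)

  cyclotomic : ℕ → Carrier → Poly
  cyclotomic n ζ = productᴾ (map (λ k → X- (ζ ^ k)) (units n))

  -- In characteristic zero at most one sequence a satisfies this.
  HasIntegerCoefficients : Poly → (ℕ → ℤ) → Set ℓ₁
  HasIntegerCoefficients f a = ∀ n → coeff f n ≈ fromℤ (a n)

-- Expanding
--   Φ(x) = (1 - x^p)(1 - x^q)(1 - x^r)(1 - x^pqr) / ((1 - x)(1 - x^pq)(1 - x^pr)(1 - x^qr))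
-- as a power series shows that, for n < pqr, the coefficient a(n) is the sum over 0 ≤ j < p of
--   [t(m) ≥ 0] - [t(m - r) ≥ 0] - [t(m - q) ≥ 0] + [t(m - q - r) ≥ 0],   m = n - j,
-- where t is read off the unique representation m = qr t + pr y + pq z with 0 ≤ y < q, 0 ≤ z < r.
-- Replacing m by m - r adds -q' or p - q' to t, replacing m by m - q adds -r' or p - r', all four
-- values of t lie in a half-open interval of length 2p whose end is below p, and the values
-- t(n - j) are distinct modulo p. Exchanging the two ends of the first kind of step negates the
-- sum and turns q' into p - q', and likewise for r', so one may replace q', r' by a ≤ b ≤ p/2;
-- then a = α and b = β*. Now a positive summand equals 1 and confines t modulo p to an interval of
-- length p - b, and also to the union of [0, a) with an interval of length a + b; a negative
-- summand equals -1 and confines t modulo p to [a, a + b).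
module Submission where

-- No power series is divided. The product formula is used with denominators cleared, each factor
-- x^d - 1 acting on sequences as f(m - d) - f(m). Its two sides are products of x - ζ^k over equal
-- multisets of exponents, and on sequences without negative exponents these operators are
-- injective, which justifies the final cancellation. The bracket [t(m) ≥ 0] arises because below
-- x^pqr it is the series of 1/((1 - x^pq)(1 - x^pr)(1 - x^qr)): a nonnegative representation of m <
-- pqr has t < p, y < q and z < r, so there is at most one. The window of length 2p ends at θ =
-- floor(n/qr). Indeed qr t ≤ m, while y ≤ q - 1 and z ≤ r - 1 give m + pr + pq ≤ qr (t + 2p), and
-- every argument satisfies n - pr - pq < m ≤ n. As θ does not depend on j, the interval of length a
-- + b, which starts at θ + 1 once t is raised by 2p, is common to all summands. No summand reaches
-- 2 or -2, because the carry that decides between -q' and p - q' is the same at m and at m - q.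

open import Defs

-- Sign patterns of the four brackets.

module Squares where
  open import Data.Integer.Base hiding (sign; Positive; Negative)
  open import Data.Integer.Properties
  open import Data.Integer.Solver using (module +-*-Solver)
  open +-*-Solver using (solve; _:+_; _:-_; :-_; _:=_; con)
  open import Data.Nat.Base as ℕ using (ℕ)
  open import Data.Product.Base using (_×_; _,_)
  open import Data.Sum.Base using (_⊎_; inj₁; inj₂)
  open import Relation.Nullary.Decidable using (True; toWitness)
  open import Relation.Binary.PropositionalEquality

  infixl 6 _⊕_
  -- Inequalities are kept in the form 0 ≤ e, so that a linear consequence is a sum of hypotheses
  -- followed by one ring identity, and a contradiction is a sum equal to -1.
  _⊕_ : ∀ {x y} → 0ℤ ≤ x → 0ℤ ≤ y → 0ℤ ≤ x + y
  _⊕_ = +-mono-≤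

  ≥0-resp : ∀ {x y} → x ≡ y → 0ℤ ≤ x → 0ℤ ≤ y
  ≥0-resp refl h = h

  ≤-eval : ∀ {x i j} → x ≡ i → {_ : True (i ≤? j)} → x ≤ j
  ≤-eval refl {h} = toWitness h

  ≥-eval : ∀ {x i j} → x ≡ i → {_ : True (j ≤? i)} → j ≤ x
  ≥-eval refl {h} = toWitness h

  absurd : ∀ {x} {A : Set} → x ≡ -1ℤ → 0ℤ ≤ x → A
  absurd refl ()

  nonneg : ℤ → ℤ
  nonneg (+ _)    = 1ℤ
  nonneg -[1+ _ ] = 0ℤ

  data Sign (x : ℤ) : Set where
    is≥0 : 0ℤ ≤ x → nonneg x ≡ 1ℤ → Sign x
    is<0 : 0ℤ ≤ -1ℤ - x → nonneg x ≡ 0ℤ → Sign x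

  sign : ∀ x → Sign x
  sign (+ n)    = is≥0 (+≤+ ℕ.z≤n) refl
  sign -[1+ n ] = is<0 (+≤+ ℕ.z≤n) refl

  -- Both values are congruent to -a modulo p. A carry decides which one occurs; the sign analysis
  -- treats it as unknown and recovers it from sign changes.
  data Shift (p a : ℤ) : ℤ → Set where
    down : Shift p a (- a)
    up   : Shift p a (p - a)

  -- A change of sign reveals the carry: as a ≤ p, the upward step cannot lead from a nonnegative to
  -- a negative value. Dually for `rise`, where 0 ≤ a.
  drop : ∀ {p a d} x → 0ℤ ≤ p - a → Shift p a d →
    0ℤ ≤ x → 0ℤ ≤ -1ℤ - (x + d) → d ≡ - a
  drop x _ down _ _ = refl
  drop {p} {a} x hp up h h′ = absurd
    (solve 3 (λ x p a → (p :- a) :+ x :+ (con -1ℤ :- (x :+ (p :- a))) := con -1ℤ) refl x p a)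
    (hp ⊕ h ⊕ h′)

  rise : ∀ {p a d} x → 0ℤ ≤ a → Shift p a d →
    0ℤ ≤ -1ℤ - x → 0ℤ ≤ x + d → d ≡ p - a
  rise x _ up _ _ = refl
  rise {a = a} x ha down h h′ = absurd
    (solve 2 (λ x a → a :+ (con -1ℤ :- x) :+ (x :- a) := con -1ℤ) refl x a)
    (ha ⊕ h ⊕ h′)

  swap-≥0 : ∀ t d e → 0ℤ ≤ t + d + e → 0ℤ ≤ t + e + d
  swap-≥0 t d e = ≥0-resp (solve 3 (λ t d e → t :+ d :+ e := t :+ e :+ d) refl t d e)

  swap-<0 : ∀ t d e → 0ℤ ≤ -1ℤ - (t + d + e) → 0ℤ ≤ -1ℤ - (t + e + d)
  swap-<0 t d e = ≥0-resp
    (solve 3 (λ t d e → con -1ℤ :- (t :+ d :+ e) := con -1ℤ :- (t :+ e :+ d)) refl t d e)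

  square : ℤ → ℤ → ℤ → ℤ
  square t d e = nonneg t - nonneg (t + d) - nonneg (t + e) + nonneg (t + d + e)

  square-value : ∀ t d e {i j k l} →
    nonneg t ≡ i → nonneg (t + d) ≡ j → nonneg (t + e) ≡ k → nonneg (t + d + e) ≡ l →
    square t d e ≡ i - j - k + l
  square-value t d e refl refl refl refl = refl

  -- θ - 2p < x ≤ θ
  Window : ℤ → ℤ → ℤ → Set
  Window p θ x = 0ℤ ≤ θ - x × 0ℤ ≤ x + p + p - 1ℤ - θ

  -- The positions of t at which the sum of four brackets can be positive. If a + b ≤ p, both
  -- alternatives lie, modulo p, in [a + b, p + a); separately they lie in intervals of lengths a
  -- and a + b.
  data Gain (p a b θ t : ℤ) : Set where
    near : 0ℤ ≤ t → 0ℤ ≤ a - 1ℤ - t → Gain p a b θ t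
    far  : 0ℤ ≤ t + p + p - (a + b) → 0ℤ ≤ p + a - 1ℤ - (t + p + p) →
           0ℤ ≤ t + p + p - (θ + 1ℤ) → 0ℤ ≤ θ + a + b - (t + p + p) →
           Gain p a b θ t

  data Loss (p a b t : ℤ) : Set where
    low  : 0ℤ ≤ t - a → 0ℤ ≤ a + b - 1ℤ - t → Loss p a b t
    high : 0ℤ ≤ t + p - a → 0ℤ ≤ a + b - 1ℤ - (t + p) → Loss p a b t

  module _ {p a b θ t d e : ℤ}
    (ha : 0ℤ ≤ a) (hb : 0ℤ ≤ b) (hpa : 0ℤ ≤ p - a) (hpb : 0ℤ ≤ p - b) (hθ : 0ℤ ≤ p - 1ℤ - θ)
    (sa : Shift p a d) (sb : Shift p b e)
    where

    private
      value = square-value t d e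

      below : d ≡ - a → 0ℤ ≤ -1ℤ - (t + d) → 0ℤ ≤ a - 1ℤ - t
      below refl = ≥0-resp
        (solve 2 (λ t a → con -1ℤ :- (t :- a) := a :- con 1ℤ :- t) refl t a)

      -- Here the window replaces the sign of `t + d`: t + p - a ≤ θ ≤ p - 1. This is one of the
      -- places where θ < p matters.
      below-θ : d ≡ p - a → Window p θ (t + d) → 0ℤ ≤ a - 1ℤ - t
      below-θ refl (w , _) = ≥0-resp
        (solve 4 (λ t a p θ → (θ :- (t :+ (p :- a))) :+ (p :- con 1ℤ :- θ) := a :- con 1ℤ :- t)
          refl t a p θ)
        (w ⊕ hθ)

      -- Both steps go up. The signs at `t + d + e` and `t + d` give the first pair of bounds, of
      -- width p - b. The lower window end at `t` and the upper one at `t + d + e` give the second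
      -- pair, of width a + b.
      far-gain : d ≡ p - a → e ≡ p - b →
        Window p θ t → Window p θ (t + d + e) →
        0ℤ ≤ -1ℤ - (t + d) → 0ℤ ≤ t + d + e → Gain p a b θ t
      far-gain refl refl (_ , w) (w′ , _) h h′ = far
        (≥0-resp (solve 4 (λ t a b p →
          t :+ (p :- a) :+ (p :- b) := t :+ p :+ p :- (a :+ b)) refl t a b p) h′)
        (≥0-resp (solve 3 (λ t a p →
          con -1ℤ :- (t :+ (p :- a)) := p :+ a :- con 1ℤ :- (t :+ p :+ p)) refl t a p) h)
        (≥0-resp (solve 3 (λ t p θ →
          t :+ p :+ p :- con 1ℤ :- θ := t :+ p :+ p :- (θ :+ con 1ℤ)) refl t p θ) w)
        (≥0-resp (solve 5 (λ t a b p θ →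
          θ :- (t :+ (p :- a) :+ (p :- b)) := θ :+ a :+ b :- (t :+ p :+ p)) refl t a b p θ) w′)

      low-loss : d ≡ - a → e ≡ - b → 0ℤ ≤ t + d → 0ℤ ≤ -1ℤ - (t + d + e) → Loss p a b t
      low-loss refl refl h h′ = low h
        (≥0-resp (solve 3 (λ t a b →
          con -1ℤ :- (t :- a :- b) := a :+ b :- con 1ℤ :- t) refl t a b) h′)

      high-≥ : d ≡ p - a → 0ℤ ≤ t + d → 0ℤ ≤ t + p - a
      high-≥ refl = ≥0-resp (solve 3 (λ t a p → t :+ (p :- a) := t :+ p :- a) refl t a p)

      -- An upward second step gives t + p ≥ b; a ≤ b weakens this to the left end a shared by all
      -- negative patterns.
      high-≥′ : e ≡ p - b → 0ℤ ≤ b - a → 0ℤ ≤ t + e → 0ℤ ≤ t + p - a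
      high-≥′ refl hba h = ≥0-resp
        (solve 4 (λ t a b p → t :+ (p :- b) :+ (b :- a) := t :+ p :- a) refl t a b p) (h ⊕ hba)

      high-≤ : d ≡ p - a → e ≡ - b → 0ℤ ≤ -1ℤ - (t + d + e) → 0ℤ ≤ a + b - 1ℤ - (t + p)
      high-≤ refl refl = ≥0-resp (solve 4 (λ t a b p →
        con -1ℤ :- (t :+ (p :- a) :- b) := a :+ b :- con 1ℤ :- (t :+ p)) refl t a b p)

      high-≤′ : d ≡ - a → e ≡ p - b → 0ℤ ≤ -1ℤ - (t + d + e) → 0ℤ ≤ a + b - 1ℤ - (t + p)
      high-≤′ refl refl = ≥0-resp (solve 4 (λ t a b p →
        con -1ℤ :- (t :- a :+ (p :- b)) := a :+ b :- con 1ℤ :- (t :+ p)) refl t a b p)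

      high-≤-θ : d ≡ p - a → e ≡ p - b → Window p θ (t + d + e) → 0ℤ ≤ a + b - 1ℤ - (t + p)
      high-≤-θ refl refl (w , _) = ≥0-resp (solve 5 (λ t a b p θ →
        (θ :- (t :+ (p :- a) :+ (p :- b))) :+ (p :- con 1ℤ :- θ) :=
        a :+ b :- con 1ℤ :- (t :+ p)) refl t a b p θ) (w ⊕ hθ)

      -- Excludes the pattern + - - +, of value 2: a step that goes down at `t` cannot take `t + e`
      -- from a negative to a nonnegative value. `not-both′` excludes - + + -, of value -2, in the
      -- same way.
      not-both : ∀ {A : Set} → d ≡ - a → 0ℤ ≤ -1ℤ - (t + e) → 0ℤ ≤ t + e + d → A
      not-both refl h h′ = absurd
        (solve 3 (λ t e a → a :+ (con -1ℤ :- (t :+ e)) :+ (t :+ e :- a) := con -1ℤ) refl t e a)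
        (ha ⊕ h ⊕ h′)

      not-both′ : ∀ {A : Set} → d ≡ p - a → 0ℤ ≤ t + e → 0ℤ ≤ -1ℤ - (t + e + d) → A
      not-both′ refl h h′ = absurd
        (solve 4 (λ t e a p → (p :- a) :+ (t :+ e) :+ (con -1ℤ :- (t :+ e :+ (p :- a))) := con -1ℤ)
          refl t e a p)
        (hpa ⊕ h ⊕ h′)

    square-upper : Window p θ t → Window p θ (t + d) → Window p θ (t + d + e) →
      square t d e ≤ 0ℤ ⊎ (square t d e ≤ 1ℤ × Gain p a b θ t)
    square-upper w0 w1 w3
      with sign t | sign (t + d) | sign (t + e) | sign (t + d + e)
    ... | is≥0 _ s0 | is≥0 _ s1 | is≥0 _ s2 | is≥0 _ s3 = inj₁ (≤-eval (value s0 s1 s2 s3))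
    ... | is≥0 _ s0 | is≥0 _ s1 | is≥0 _ s2 | is<0 _ s3 = inj₁ (≤-eval (value s0 s1 s2 s3))
    ... | is≥0 _ s0 | is<0 _ s1 | is≥0 _ s2 | is<0 _ s3 = inj₁ (≤-eval (value s0 s1 s2 s3))
    ... | is≥0 h0 s0 | is<0 h1 s1 | is≥0 _ s2 | is≥0 _ s3 =
      inj₂ (≤-eval (value s0 s1 s2 s3) , near h0 (below (drop t hpa sa h0 h1) h1))
    ... | is≥0 _ s0 | is≥0 _ s1 | is<0 _ s2 | is<0 _ s3 = inj₁ (≤-eval (value s0 s1 s2 s3))
    -- The signs at `t` and `t + d` do not show the direction of `d`, but the opposite edge from
    -- `t + e` does: it rises, so d = p - a, and the window at `t + d` bounds `t`.
    ... | is≥0 h0 s0 | is≥0 _ s1 | is<0 h2 s2 | is≥0 h3 s3 =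
      inj₂ (≤-eval (value s0 s1 s2 s3) ,
        near h0 (below-θ (rise (t + e) ha sa h2 (swap-≥0 t d e h3)) w1))
    ... | is≥0 h0 s0 | is<0 h1 s1 | is<0 _ s2 | is<0 _ s3 =
      inj₂ (≤-eval (value s0 s1 s2 s3) , near h0 (below (drop t hpa sa h0 h1) h1))
    ... | is≥0 h0 _ | is<0 h1 _ | is<0 h2 _ | is≥0 h3 _ =
      not-both (drop t hpa sa h0 h1) h2 (swap-≥0 t d e h3)
    ... | is<0 _ s0 | is≥0 _ s1 | is≥0 _ s2 | is≥0 _ s3 = inj₁ (≤-eval (value s0 s1 s2 s3))
    ... | is<0 _ s0 | is≥0 _ s1 | is≥0 _ s2 | is<0 _ s3 = inj₁ (≤-eval (value s0 s1 s2 s3))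
    ... | is<0 _ s0 | is≥0 _ s1 | is<0 _ s2 | is≥0 _ s3 = inj₁ (≤-eval (value s0 s1 s2 s3))
    ... | is<0 _ s0 | is≥0 _ s1 | is<0 _ s2 | is<0 _ s3 = inj₁ (≤-eval (value s0 s1 s2 s3))
    ... | is<0 _ s0 | is<0 _ s1 | is≥0 _ s2 | is≥0 _ s3 = inj₁ (≤-eval (value s0 s1 s2 s3))
    ... | is<0 _ s0 | is<0 _ s1 | is≥0 _ s2 | is<0 _ s3 = inj₁ (≤-eval (value s0 s1 s2 s3))
    ... | is<0 _ s0 | is<0 _ s1 | is<0 _ s2 | is<0 _ s3 = inj₁ (≤-eval (value s0 s1 s2 s3))
    ... | is<0 _ s0 | is<0 h1 s1 | is<0 h2 s2 | is≥0 h3 s3 =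
      inj₂ (≤-eval (value s0 s1 s2 s3) ,
        far-gain (rise (t + e) ha sa h2 (swap-≥0 t d e h3)) (rise (t + d) hb sb h1 h3) w0 w3 h1 h3)

    square-lower : 0ℤ ≤ b - a → Window p θ (t + d + e) →
      0ℤ ≤ square t d e ⊎ (-1ℤ ≤ square t d e × Loss p a b t)
    square-lower hba w3
      with sign t | sign (t + d) | sign (t + e) | sign (t + d + e)
    ... | is≥0 _ s0 | is≥0 _ s1 | is≥0 _ s2 | is≥0 _ s3 = inj₁ (≥-eval (value s0 s1 s2 s3))
    ... | is≥0 _ s0 | is≥0 h1 s1 | is≥0 h2 s2 | is<0 h3 s3 =
      inj₂ (≥-eval (value s0 s1 s2 s3) ,
        low-loss (drop (t + e) hpa sa h2 (swap-<0 t d e h3)) (drop (t + d) hpb sb h1 h3) h1 h3)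
    ... | is≥0 _ s0 | is≥0 _ s1 | is<0 _ s2 | is≥0 _ s3 = inj₁ (≥-eval (value s0 s1 s2 s3))
    ... | is≥0 _ s0 | is≥0 _ s1 | is<0 _ s2 | is<0 _ s3 = inj₁ (≥-eval (value s0 s1 s2 s3))
    ... | is≥0 _ s0 | is<0 _ s1 | is≥0 _ s2 | is≥0 _ s3 = inj₁ (≥-eval (value s0 s1 s2 s3))
    ... | is≥0 _ s0 | is<0 _ s1 | is≥0 _ s2 | is<0 _ s3 = inj₁ (≥-eval (value s0 s1 s2 s3))
    ... | is≥0 _ s0 | is<0 _ s1 | is<0 _ s2 | is≥0 _ s3 = inj₁ (≥-eval (value s0 s1 s2 s3))
    ... | is≥0 _ s0 | is<0 _ s1 | is<0 _ s2 | is<0 _ s3 = inj₁ (≥-eval (value s0 s1 s2 s3))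
    -- Both steps go up and `t + d + e` is nonnegative, so no sign bounds `t` from above; the upper
    -- end of the window does.
    ... | is<0 h0 s0 | is≥0 h1 s1 | is≥0 h2 s2 | is≥0 _ s3 =
      inj₂ (≥-eval (value s0 s1 s2 s3) ,
        high (high-≥ d↑ h1) (high-≤-θ d↑ (rise t hb sb h0 h2) w3))
      where
      d↑ : d ≡ p - a
      d↑ = rise t ha sa h0 h1
    ... | is<0 h0 _ | is≥0 h1 _ | is≥0 h2 _ | is<0 h3 _ =
      not-both′ (rise t ha sa h0 h1) h2 (swap-<0 t d e h3)
    ... | is<0 _ s0 | is≥0 _ s1 | is<0 _ s2 | is≥0 _ s3 = inj₁ (≥-eval (value s0 s1 s2 s3))
    ... | is<0 h0 s0 | is≥0 h1 s1 | is<0 _ s2 | is<0 h3 s3 =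
      inj₂ (≥-eval (value s0 s1 s2 s3) ,
        high (high-≥ d↑ h1) (high-≤ d↑ (drop (t + d) hpb sb h1 h3) h3))
      where
      d↑ : d ≡ p - a
      d↑ = rise t ha sa h0 h1
    ... | is<0 _ s0 | is<0 _ s1 | is≥0 _ s2 | is≥0 _ s3 = inj₁ (≥-eval (value s0 s1 s2 s3))
    ... | is<0 h0 s0 | is<0 _ s1 | is≥0 h2 s2 | is<0 h3 s3 =
      inj₂ (≥-eval (value s0 s1 s2 s3) ,
        high (high-≥′ e↑ hba h2) (high-≤′ (drop (t + e) hpa sa h2 (swap-<0 t d e h3)) e↑ h3))
      where
      e↑ : e ≡ p - b
      e↑ = rise t hb sb h0 h2
    ... | is<0 _ s0 | is<0 _ s1 | is<0 _ s2 | is≥0 _ s3 = inj₁ (≥-eval (value s0 s1 s2 s3))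
    ... | is<0 _ s0 | is<0 _ s1 | is<0 _ s2 | is<0 _ s3 = inj₁ (≥-eval (value s0 s1 s2 s3))

-- Counting residues in an interval.

module ResidueCounting where
  open Squares
  open import Data.Integer.Base hiding (sign; Positive; Negative)
  open import Data.Integer.Properties
  open import Data.Integer.Divisibility.Signed using (_∣_; _∣?_; divides; ∣m∣n⇒∣m-n)
  open import Data.Integer.Solver using (module +-*-Solver)
  open +-*-Solver using (solve; _:+_; _:-_; :-_; _:*_; _:=_; con)
  open import Data.Nat.Base as ℕ using (ℕ; zero; suc)
  import Data.Nat.Properties as ℕ
  open import Data.Product.Base using (_,_; ∃; proj₂)
  open import Data.Sum.Base using (inj₁; inj₂)
  open import Relation.Nullary.Decidable using (Dec; yes; no)
  open import Relation.Nullary.Negation using (contradiction)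
  open import Relation.Binary.PropositionalEquality

  sum< : ℕ → (ℕ → ℤ) → ℤ
  sum< zero    f = 0ℤ
  sum< (suc n) f = sum< n f + f n

  sum<-mono : ∀ n {f g} → (∀ j → j ℕ.< n → f j ≤ g j) → sum< n f ≤ sum< n g
  sum<-mono zero    h = ≤-refl
  sum<-mono (suc n) h =
    +-mono-≤ (sum<-mono n (λ j j<n → h j (ℕ.m<n⇒m<1+n j<n))) (h n ℕ.≤-refl)

  sum<-cong : ∀ n {f g} → (∀ j → f j ≡ g j) → sum< n f ≡ sum< n g
  sum<-cong zero    h = refl
  sum<-cong (suc n) h = cong₂ _+_ (sum<-cong n h) (h n)

  sum<-+ : ∀ n f g → sum< n (λ j → f j + g j) ≡ sum< n f + sum< n g
  sum<-+ zero    f g = refl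
  sum<-+ (suc n) f g rewrite sum<-+ n f g =
    solve 4 (λ a b c d → a :+ b :+ (c :+ d) := a :+ c :+ (b :+ d)) refl
      (sum< n f) (sum< n g) (f n) (g n)

  sum<-neg : ∀ n f → sum< n (λ j → - f j) ≡ - sum< n f
  sum<-neg zero    f = refl
  sum<-neg (suc n) f rewrite sum<-neg n f = sym (neg-distrib-+ (sum< n f) (f n))

  sum<-const : ∀ n c → sum< n (λ _ → c) ≡ + n * c
  sum<-const zero    c = refl
  sum<-const (suc n) c rewrite sum<-const n c =
    trans (+-comm (+ n * c) c) (sym (suc-* (+ n) c))

  sum<-zero : ∀ n → sum< n (λ _ → 0ℤ) ≡ 0ℤ
  sum<-zero n = trans (sum<-const n 0ℤ) (*-zeroʳ (+ n))

  sum<-nonneg : ∀ n {f} → (∀ j → 0ℤ ≤ f j) → 0ℤ ≤ sum< n f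
  sum<-nonneg zero    h = ≤-refl
  sum<-nonneg (suc n) h = +-mono-≤ (sum<-nonneg n h) (h n)

  sum<-swap : ∀ m n (f : ℕ → ℕ → ℤ) →
    sum< m (λ i → sum< n (f i)) ≡ sum< n (λ j → sum< m (λ i → f i j))
  sum<-swap zero    n f = sym (sum<-zero n)
  sum<-swap (suc m) n f rewrite sum<-swap m n f =
    sym (sum<-+ n (λ j → sum< m (λ i → f i j)) (f m))

  indicator : ∀ {P : Set} → Dec P → ℤ
  indicator (yes _) = 1ℤ
  indicator (no _)  = 0ℤ

  indicator-nonneg : ∀ {P : Set} (P? : Dec P) → 0ℤ ≤ indicator P?
  indicator-nonneg (yes _) = +≤+ ℕ.z≤n
  indicator-nonneg (no _)  = ≤-refl

  indicator-no : ∀ {P : Set} (P? : Dec P) → (P → ∃ λ n → n ℕ.< n) → indicator P? ≤ 0ℤ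
  indicator-no (yes p) ¬p = contradiction (proj₂ (¬p p)) (ℕ.<-irrefl refl)
  indicator-no (no _)  _  = ≤-refl

  sum<-indicator≤1 : ∀ n {P : ℕ → Set} (P? : ∀ j → Dec (P j)) →
    (∀ i j → i ℕ.< n → j ℕ.< n → P i → P j → i ≡ j) →
    sum< n (λ j → indicator (P? j)) ≤ 1ℤ
  sum<-indicator≤1 zero    P? unique = +≤+ ℕ.z≤n
  sum<-indicator≤1 (suc n) P? unique with P? n
  ... | no _ rewrite +-identityʳ (sum< n (λ j → indicator (P? j))) =
    sum<-indicator≤1 n P? (λ i j i<n j<n → unique i j (ℕ.m<n⇒m<1+n i<n) (ℕ.m<n⇒m<1+n j<n))
  ... | yes pn = +-mono-≤ {y = 0ℤ} (≤-trans
      (sum<-mono n (λ j j<n → indicator-no (P? j) λ pj →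
        j , subst (j ℕ.<_) (sym (unique j n (ℕ.m<n⇒m<1+n j<n) ℕ.≤-refl pj pn)) j<n))
      (≤-reflexive (sum<-zero n)))
      (≤-refl {1ℤ})

  sum<-indicator≥1 : ∀ n {P : ℕ → Set} (P? : ∀ j → Dec (P j)) {i} → i ℕ.< n → P i →
    1ℤ ≤ sum< n (λ j → indicator (P? j))
  sum<-indicator≥1 (suc n) P? {i} i<1+n pi with ℕ.m≤n⇒m<n∨m≡n (ℕ.s≤s⁻¹ i<1+n)
  ... | inj₁ i<n = +-mono-≤ (sum<-indicator≥1 n P? i<n pi) (indicator-nonneg (P? n))
  ... | inj₂ refl with P? i
  ...   | yes _  = +-mono-≤
    (sum<-nonneg n (λ j → indicator-nonneg (P? j))) (≤-refl {1ℤ})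
  ...   | no ¬pi = contradiction pi ¬pi

  hits : (p : ℕ) → ℤ → ℕ → ℤ → ℤ
  hits p lo B x = sum< B (λ i → indicator (+ p ∣? (x - (lo + + i))))

  hits-nonneg : ∀ p lo B x → 0ℤ ≤ hits p lo B x
  hits-nonneg p lo B x = sum<-nonneg B (λ i → indicator-nonneg (+ p ∣? (x - (lo + + i))))

  -- `k` is the multiple of p that carries x into the interval; the offset that is hit is
  -- `x + k * p - lo` itself.
  hits≥1 : ∀ p lo B x k → 0ℤ ≤ x + k * + p - lo → 0ℤ ≤ lo + + B - 1ℤ - (x + k * + p) →
    1ℤ ≤ hits p lo B x
  hits≥1 p lo B x k h h′ with x + k * + p - lo in eq
  ... | + i = sum<-indicator≥1 B (λ i → + p ∣? (x - (lo + + i))) {i} i<B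
    (divides (- k) x-lo-i)
    where
    x-lo-i : x - (lo + + i) ≡ - k * + p
    x-lo-i = trans (cong (λ y → x - (lo + y)) (sym eq))
      (solve 4 (λ x k p lo → x :- (lo :+ (x :+ k :* p :- lo)) := :- k :* p) refl x k (+ p) lo)
    i<B : i ℕ.< B
    i<B = drop‿+≤+ (0≤i-j⇒j≤i (≥0-resp (trans
      (solve 3 (λ lo B y → lo :+ B :- con 1ℤ :- y := B :- (con 1ℤ :+ (y :- lo))) refl
        lo (+ B) (x + k * + p))
      (cong (λ y → + B - (1ℤ + y)) eq)) h′))

  Distinct : ℕ → (ℕ → ℤ) → Set
  Distinct p t = ∀ i j → i ℕ.< p → j ℕ.< p → + p ∣ t i - t j → i ≡ j

  -- Double counting: after exchanging the sums, each of the B points is congruent to at most one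
  -- `t j`, because these are distinct modulo p.
  sum<-hits : ∀ p lo B t → Distinct p t → sum< p (λ j → hits p lo B (t j)) ≤ + B
  sum<-hits p lo B t distinct = begin
    sum< p (λ j → sum< B (λ i → indicator (+ p ∣? (t j - (lo + + i)))))
      ≡⟨ sum<-swap p B (λ j i → indicator (+ p ∣? (t j - (lo + + i)))) ⟩
    sum< B (λ i → sum< p (λ j → indicator (+ p ∣? (t j - (lo + + i)))))
      ≤⟨ sum<-mono B (λ i _ → sum<-indicator≤1 p (λ j → + p ∣? (t j - (lo + + i)))
           (λ j k j<p k<p h h′ → distinct j k j<p k<p (difference j k i h h′))) ⟩
    sum< B (λ _ → 1ℤ)
      ≡⟨ trans (sum<-const B 1ℤ) (*-identityʳ (+ B)) ⟩
    + B ∎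
    where
    open ≤-Reasoning
    difference : ∀ j k i → + p ∣ t j - (lo + + i) → + p ∣ t k - (lo + + i) → + p ∣ t j - t k
    difference j k i h h′ = subst (+ p ∣_)
      (solve 3 (λ x y v → x :- v :- (y :- v) := x :- y) refl (t j) (t k) (lo + + i))
      (∣m∣n⇒∣m-n h h′)

-- The estimate for an abstract family of squares, and its symmetries.

module Families where
  open Squares
  open ResidueCounting
  open import Data.Integer.Base hiding (sign; Positive; Negative; _⊓_; _⊔_)
  open import Data.Integer.Properties
  open import Data.Integer.Divisibility.Signed using (_∣_; ∣m∣n⇒∣m-n; divides)
  open import Data.Integer.Solver using (module +-*-Solver)
  open +-*-Solver using (solve; _:+_; _:-_; :-_; _:*_; _:=_; con)
  open import Data.Nat.Base as ℕ using (ℕ; _∸_; _⊓_; _⊔_)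
  import Data.Nat.Properties as ℕ
  open import Data.Product.Base using (_×_; _,_)
  open import Data.Sum.Base using (_⊎_; inj₁; inj₂)
  open import Relation.Binary.PropositionalEquality

  -- Only these properties of the values t(n - j) enter the estimate. They survive exchanging the
  -- two steps and reversing one of them, so the reduction to a ≤ b ≤ p/2 is carried out here,
  -- without touching q, r or n.
  record Family (p : ℕ) (θ : ℤ) (a b : ℕ) : Set where
    field
      t d e    : ℕ → ℤ
      shift₁   : ∀ j → Shift (+ p) (+ a) (d j)
      shift₂   : ∀ j → Shift (+ p) (+ b) (e j)
      window₀  : ∀ j → j ℕ.< p → Window (+ p) θ (t j)
      window₁  : ∀ j → j ℕ.< p → Window (+ p) θ (t j + d j)
      window₂  : ∀ j → j ℕ.< p → Window (+ p) θ (t j + e j)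
      window₁₂ : ∀ j → j ℕ.< p → Window (+ p) θ (t j + d j + e j)
      distinct : Distinct p t

    total : ℤ
    total = sum< p (λ j → square (t j) (d j) (e j))

  open Family using (total)

  +∸ : ∀ {m n} → n ℕ.≤ m → + (m ∸ n) ≡ + m - + n
  +∸ {m} {n} n≤m = trans (sym (⊖-≥ n≤m)) (sym (m-n≡m⊖n m n))

  ≤⇒0≤- : ∀ {m n} → m ℕ.≤ n → 0ℤ ≤ + n - + m
  ≤⇒0≤- m≤n = i≤j⇒0≤j-i (+≤+ m≤n)

  module _ {p θ a b} (F : Family p θ a b) (hθ : 0ℤ ≤ + p - 1ℤ - θ)
    (a≤p : a ℕ.≤ p) (b≤p : b ℕ.≤ p) where
    open Family F hiding (total)

    private
      upper : ∀ j → j ℕ.< p → let s = square (t j) (d j) (e j) in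
        s ≤ 0ℤ ⊎ (s ≤ 1ℤ × Gain (+ p) (+ a) (+ b) θ (t j))
      upper j j<p = square-upper (+≤+ ℕ.z≤n) (+≤+ ℕ.z≤n) (≤⇒0≤- a≤p) (≤⇒0≤- b≤p) hθ
        (shift₁ j) (shift₂ j) (window₀ j j<p) (window₁ j j<p) (window₁₂ j j<p)

    -- One interval [a + b, p + a) serves both alternatives: `near` reaches it after adding p, since
    -- t ≥ 0 and a + b ≤ p, and `far` after adding 2p.
    total≤p-b : a ℕ.+ b ℕ.≤ p → total F ≤ + (p ∸ b)
    total≤p-b a+b≤p = ≤-trans (sum<-mono p bound) (sum<-hits p (+ a + + b) (p ∸ b) t distinct)
      where
      gap : 0ℤ ≤ + p - (+ a + + b)
      gap = ≤⇒0≤- a+b≤p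

      covered : ∀ {x} → Gain (+ p) (+ a) (+ b) θ x → 1ℤ ≤ hits p (+ a + + b) (p ∸ b) x
      covered {x} (near h h′) = hits≥1 p (+ a + + b) (p ∸ b) x 1ℤ
        (≥0-resp (solve 4 (λ x p a b → x :+ (p :- (a :+ b)) := x :+ con 1ℤ :* p :- (a :+ b)) refl
          x (+ p) (+ a) (+ b)) (h ⊕ gap))
        (subst (λ w → 0ℤ ≤ + a + + b + w - 1ℤ - (x + 1ℤ * + p)) (sym (+∸ b≤p))
          (≥0-resp (solve 4 (λ x p a b →
            a :- con 1ℤ :- x := a :+ b :+ (p :- b) :- con 1ℤ :- (x :+ con 1ℤ :* p)) refl
            x (+ p) (+ a) (+ b)) h′))
      covered {x} (far h h′ _ _) = hits≥1 p (+ a + + b) (p ∸ b) x (+ 2)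
        (≥0-resp (solve 4 (λ x p a b →
          x :+ p :+ p :- (a :+ b) := x :+ con (+ 2) :* p :- (a :+ b)) refl
          x (+ p) (+ a) (+ b)) h)
        (subst (λ w → 0ℤ ≤ + a + + b + w - 1ℤ - (x + + 2 * + p)) (sym (+∸ b≤p))
          (≥0-resp (solve 4 (λ x p a b → p :+ a :- con 1ℤ :- (x :+ p :+ p) :=
            a :+ b :+ (p :- b) :- con 1ℤ :- (x :+ con (+ 2) :* p)) refl
            x (+ p) (+ a) (+ b)) h′))

      bound : ∀ j → j ℕ.< p →
        square (t j) (d j) (e j) ≤ hits p (+ a + + b) (p ∸ b) (t j)
      bound j j<p with upper j j<p
      ... | inj₁ s≤0       = ≤-trans s≤0 (hits-nonneg p (+ a + + b) (p ∸ b) (t j))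
      ... | inj₂ (s≤1 , g) = ≤-trans s≤1 (covered g)

    -- `near` hits [0, a) directly and `far` hits [θ + 1, θ + a + b] after adding 2p. Since one hit
    -- in either interval pays for a summand, the lengths a and a + b add up.
    total≤2a+b : total F ≤ + (2 ℕ.* a ℕ.+ b)
    total≤2a+b = begin
      total F
        ≤⟨ sum<-mono p bound ⟩
      sum< p (λ j → hits p 0ℤ a (t j) + hits p (θ + 1ℤ) (a ℕ.+ b) (t j))
        ≡⟨ sum<-+ p (λ j → hits p 0ℤ a (t j)) (λ j → hits p (θ + 1ℤ) (a ℕ.+ b) (t j)) ⟩
      sum< p (λ j → hits p 0ℤ a (t j)) + sum< p (λ j → hits p (θ + 1ℤ) (a ℕ.+ b) (t j))
        ≤⟨ +-mono-≤ (sum<-hits p 0ℤ a t distinct) (sum<-hits p (θ + 1ℤ) (a ℕ.+ b) t distinct) ⟩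
      + (a ℕ.+ (a ℕ.+ b))
        ≡⟨ cong +_ (trans (sym (ℕ.+-assoc a a b))
             (cong (λ x → a ℕ.+ x ℕ.+ b) (sym (ℕ.+-identityʳ a)))) ⟩
      + (2 ℕ.* a ℕ.+ b) ∎
      where
      open ≤-Reasoning

      nn₁ : ∀ x → 0ℤ ≤ hits p 0ℤ a x
      nn₁ = hits-nonneg p 0ℤ a
      nn₂ : ∀ x → 0ℤ ≤ hits p (θ + 1ℤ) (a ℕ.+ b) x
      nn₂ = hits-nonneg p (θ + 1ℤ) (a ℕ.+ b)

      covered : ∀ {x} → Gain (+ p) (+ a) (+ b) θ x →
        1ℤ ≤ hits p 0ℤ a x + hits p (θ + 1ℤ) (a ℕ.+ b) x
      covered {x} (near h h′) = +-mono-≤ {1ℤ} {hits p 0ℤ a x} {0ℤ}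
        (hits≥1 p 0ℤ a x 0ℤ
          (≥0-resp (solve 2 (λ x p → x := x :+ con 0ℤ :* p :- con 0ℤ) refl x (+ p)) h)
          (≥0-resp (solve 3 (λ x p a →
            a :- con 1ℤ :- x := con 0ℤ :+ a :- con 1ℤ :- (x :+ con 0ℤ :* p)) refl
            x (+ p) (+ a)) h′))
        (nn₂ x)
      covered {x} (far _ _ h h′) = +-mono-≤ {0ℤ} {hits p 0ℤ a x} {1ℤ} (nn₁ x)
        (hits≥1 p (θ + 1ℤ) (a ℕ.+ b) x (+ 2)
          (≥0-resp (solve 3 (λ x p θ →
            x :+ p :+ p :- (θ :+ con 1ℤ) := x :+ con (+ 2) :* p :- (θ :+ con 1ℤ)) refl
            x (+ p) θ) h)
          (≥0-resp (solve 5 (λ x p θ a b → θ :+ a :+ b :- (x :+ p :+ p) :=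
            θ :+ con 1ℤ :+ (a :+ b) :- con 1ℤ :- (x :+ con (+ 2) :* p)) refl
            x (+ p) θ (+ a) (+ b)) h′))

      bound : ∀ j → j ℕ.< p →
        square (t j) (d j) (e j) ≤ hits p 0ℤ a (t j) + hits p (θ + 1ℤ) (a ℕ.+ b) (t j)
      bound j j<p with upper j j<p
      ... | inj₁ s≤0       = ≤-trans s≤0 (+-mono-≤ (nn₁ (t j)) (nn₂ (t j)))
      ... | inj₂ (s≤1 , g) = ≤-trans s≤1 (covered g)

    -total≤b : a ℕ.≤ b → - total F ≤ + b
    -total≤b a≤b = begin
      - total F
        ≡⟨ sum<-neg p (λ j → square (t j) (d j) (e j)) ⟨
      sum< p (λ j → - square (t j) (d j) (e j))
        ≤⟨ sum<-mono p bound ⟩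
      sum< p (λ j → hits p (+ a) b (t j))
        ≤⟨ sum<-hits p (+ a) b t distinct ⟩
      + b ∎
      where
      open ≤-Reasoning

      covered : ∀ {x} → Loss (+ p) (+ a) (+ b) x → 1ℤ ≤ hits p (+ a) b x
      covered {x} (low h h′) = hits≥1 p (+ a) b x 0ℤ
        (≥0-resp (solve 3 (λ x p a → x :- a := x :+ con 0ℤ :* p :- a) refl x (+ p) (+ a)) h)
        (≥0-resp (solve 4 (λ x p a b →
          a :+ b :- con 1ℤ :- x := a :+ b :- con 1ℤ :- (x :+ con 0ℤ :* p)) refl
          x (+ p) (+ a) (+ b)) h′)
      covered {x} (high h h′) = hits≥1 p (+ a) b x 1ℤ
        (≥0-resp (solve 3 (λ x p a → x :+ p :- a := x :+ con 1ℤ :* p :- a) refl x (+ p) (+ a)) h)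
        (≥0-resp (solve 4 (λ x p a b →
          a :+ b :- con 1ℤ :- (x :+ p) := a :+ b :- con 1ℤ :- (x :+ con 1ℤ :* p)) refl
          x (+ p) (+ a) (+ b)) h′)

      bound : ∀ j → j ℕ.< p → - square (t j) (d j) (e j) ≤ hits p (+ a) b (t j)
      bound j j<p
        with square-lower {t = t j} (+≤+ ℕ.z≤n) (+≤+ ℕ.z≤n) (≤⇒0≤- a≤p) (≤⇒0≤- b≤p) hθ
               (shift₁ j) (shift₂ j) (≤⇒0≤- a≤b) (window₁₂ j j<p)
      ... | inj₁ 0≤s        = ≤-trans (neg-mono-≤ 0≤s) (hits-nonneg p (+ a) b (t j))
      ... | inj₂ (-1≤s , l) = ≤-trans (neg-mono-≤ -1≤s) (covered l)

  flip-shift : ∀ {p a d} → a ℕ.≤ p → Shift (+ p) (+ a) d → Shift (+ p) (+ (p ∸ a)) (- d)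
  flip-shift {p} {a} a≤p down = subst (Shift (+ p) (+ (p ∸ a)))
    (trans (cong (λ x → + p - x) (+∸ a≤p))
      (solve 2 (λ p a → p :- (p :- a) := :- (:- a)) refl (+ p) (+ a)))
    up
  flip-shift {p} {a} a≤p up = subst (Shift (+ p) (+ (p ∸ a))) (cong -_ (+∸ a≤p)) down

  -- Passing from t to t + d translates all residues by the same -a, so the new base points in
  -- `reflect` stay distinct modulo p.
  ∣-shift : ∀ {p a d d′} → Shift p a d → Shift p a d′ → p ∣ d - d′
  ∣-shift {p} {a} down down = divides 0ℤ (solve 2 (λ p a → :- a :- :- a := con 0ℤ :* p) refl p a)
  ∣-shift {p} {a} down up = divides -1ℤ (solve 2 (λ p a → :- a :- (p :- a) := con -1ℤ :* p) refl p a)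
  ∣-shift {p} {a} up down = divides 1ℤ (solve 2 (λ p a → p :- a :- :- a := con 1ℤ :* p) refl p a)
  ∣-shift {p} {a} up up = divides 0ℤ (solve 2 (λ p a → p :- a :- (p :- a) := con 0ℤ :* p) refl p a)

  module _ {p θ a b} (F : Family p θ a b) where
    open Family F hiding (total)

    transpose : Family p θ b a
    transpose = record
      { t = t ; d = e ; e = d
      ; shift₁ = shift₂ ; shift₂ = shift₁
      ; window₀ = window₀ ; window₁ = window₂ ; window₂ = window₁
      ; window₁₂ = λ j j<p → subst (Window (+ p) θ) (swap-shifts (t j) (d j) (e j)) (window₁₂ j j<p)
      ; distinct = distinct
      }
      where
      swap-shifts : ∀ t d e → t + d + e ≡ t + e + d
      swap-shifts = solve 3 (λ t d e → t :+ d :+ e := t :+ e :+ d) refl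

    total-transpose : total transpose ≡ total F
    total-transpose = sum<-cong p λ j → trans
      (cong (λ x → nonneg (t j) - nonneg (t j + e j) - nonneg (t j + d j) + nonneg x)
        (solve 3 (λ t d e → t :+ e :+ d := t :+ d :+ e) refl (t j) (d j) (e j)))
      (solve 4 (λ x y z w → x :- z :- y :+ w := x :- y :- z :+ w) refl
        (nonneg (t j)) (nonneg (t j + d j)) (nonneg (t j + e j)) (nonneg (t j + d j + e j)))

    private
      undo : ∀ t d → t ≡ t + d + - d
      undo = solve 2 (λ t d → t := t :+ d :+ :- d) refl
      undo′ : ∀ t d e → t + e ≡ t + d + - d + e
      undo′ = solve 3 (λ t d e → t :+ e := t :+ d :+ :- d :+ e) refl

    -- Exchanges the ends t and t + d of every first step, which negates each summand.
    reflect : a ℕ.≤ p → Family p θ (p ∸ a) b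
    reflect a≤p = record
      { t = λ j → t j + d j ; d = λ j → - d j ; e = e
      ; shift₁ = λ j → flip-shift a≤p (shift₁ j)
      ; shift₂ = shift₂
      ; window₀ = window₁
      ; window₁ = λ j j<p → subst (Window (+ p) θ) (undo (t j) (d j)) (window₀ j j<p)
      ; window₂ = window₁₂
      ; window₁₂ = λ j j<p → subst (Window (+ p) θ) (undo′ (t j) (d j) (e j)) (window₂ j j<p)
      ; distinct = λ i j i<p j<p h → distinct i j i<p j<p
          (subst (+ p ∣_)
            (solve 4 (λ t t′ d d′ → t :+ d :- (t′ :+ d′) :- (d :- d′) := t :- t′) refl
              (t i) (t j) (d i) (d j))
            (∣m∣n⇒∣m-n h (∣-shift (shift₁ i) (shift₁ j))))
      }

    total-reflect : ∀ a≤p → total (reflect a≤p) ≡ - total F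
    total-reflect a≤p = trans
      (sum<-cong p λ j → trans
        (cong₂ (λ x y → nonneg (t j + d j) - nonneg x - nonneg (t j + d j + e j) + nonneg y)
          (sym (undo (t j) (d j))) (sym (undo′ (t j) (d j) (e j))))
        (solve 4 (λ x y z w → y :- x :- w :+ z := :- (x :- y :- z :+ w)) refl
          (nonneg (t j)) (nonneg (t j + d j)) (nonneg (t j + e j)) (nonneg (t j + d j + e j))))
      (sum<-neg p (λ j → square (t j) (d j) (e j)))

  ∣∣≤ : ∀ {x n} → x ≤ + n → - x ≤ + n → ∣ x ∣ ℕ.≤ n
  ∣∣≤ {+ _}       (+≤+ h) _ = h
  ∣∣≤ { -[1+ _ ]} _ (+≤+ h) = h

  distance : ℕ → ℕ → ℕ
  distance p a = a ⊓ (p ∸ a)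

  small-or-large : ∀ {p} a → a ℕ.≤ p →
    (a ℕ.+ a ℕ.≤ p × distance p a ≡ a) ⊎
    ((p ∸ a) ℕ.+ (p ∸ a) ℕ.≤ p × distance p a ≡ p ∸ a)
  small-or-large {p} a a≤p with ℕ.≤-total a (p ∸ a)
  ... | inj₁ h = inj₁ (subst (a ℕ.+ a ℕ.≤_) (ℕ.m+[n∸m]≡n a≤p) (ℕ.+-monoʳ-≤ a h) , ℕ.m≤n⇒m⊓n≡m h)
  ... | inj₂ h = inj₂
    (subst (p ∸ a ℕ.+ (p ∸ a) ℕ.≤_) (ℕ.m+[n∸m]≡n a≤p) (ℕ.+-monoˡ-≤ (p ∸ a) h) , ℕ.m≥n⇒m⊓n≡n h)

  -- With the arguments α and β* in either order, this is the bound of the theorem.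
  bound : ℕ → ℕ → ℕ → ℕ
  bound p a b = (2 ℕ.* (a ⊓ b) ℕ.+ (a ⊔ b)) ⊓ (p ∸ (a ⊔ b))

  module _ {p θ} (hθ : 0ℤ ≤ + p - 1ℤ - θ) where
    -- The negative side costs only b, which both bounds absorb: b ≤ 2a + b always, and b ≤ p - b
    -- because 2b ≤ p.
    bounded₁ : ∀ {a b} (F : Family p θ a b) → a ℕ.≤ b → b ℕ.+ b ℕ.≤ p →
      ∣ total F ∣ ℕ.≤ bound p a b
    bounded₁ {a} {b} F a≤b 2b≤p
      rewrite ℕ.m≤n⇒m⊓n≡m a≤b | ℕ.m≤n⇒m⊔n≡n a≤b =
      ℕ.⊓-glb
        (∣∣≤ (total≤2a+b F hθ a≤p b≤p)
          (≤-trans (-total≤b F hθ a≤p b≤p a≤b) (+≤+ (ℕ.m≤n+m b (2 ℕ.* a)))))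
        (∣∣≤ (total≤p-b F hθ a≤p b≤p (ℕ.≤-trans (ℕ.+-monoˡ-≤ b a≤b) 2b≤p))
          (≤-trans (-total≤b F hθ a≤p b≤p a≤b) (+≤+ (ℕ.m+n≤o⇒m≤o∸n b 2b≤p))))
      where
      b≤p = ℕ.m+n≤o⇒m≤o b 2b≤p
      a≤p = ℕ.≤-trans a≤b b≤p

    bounded₂ : ∀ {a b} (F : Family p θ a b) → a ℕ.+ a ℕ.≤ p → b ℕ.+ b ℕ.≤ p →
      ∣ total F ∣ ℕ.≤ bound p a b
    bounded₂ {a} {b} F 2a≤p 2b≤p with ℕ.≤-total a b
    ... | inj₁ a≤b = bounded₁ F a≤b 2b≤p
    ... | inj₂ b≤a rewrite ℕ.⊓-comm a b | ℕ.⊔-comm a b | sym (total-transpose F) =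
      bounded₁ (transpose F) b≤a 2a≤p

    ∣total-reflect∣ : ∀ {a b} (F : Family p θ a b) a≤p → ∣ total (reflect F a≤p) ∣ ≡ ∣ total F ∣
    ∣total-reflect∣ F a≤p = trans (cong ∣_∣ (total-reflect F a≤p)) (∣-i∣≡∣i∣ (total F))

    bounded₃ : ∀ {a b} (F : Family p θ a b) → a ℕ.≤ p → b ℕ.+ b ℕ.≤ p →
      ∣ total F ∣ ℕ.≤ bound p (distance p a) b
    bounded₃ {a} F a≤p 2b≤p with small-or-large a a≤p
    ... | inj₁ (2a≤p , eq) rewrite eq = bounded₂ F 2a≤p 2b≤p
    ... | inj₂ (h , eq) rewrite eq | sym (∣total-reflect∣ F a≤p) = bounded₂ (reflect F a≤p) h 2b≤p

    ∣total∣≤bound : ∀ {a b} (F : Family p θ a b) → a ℕ.≤ p → b ℕ.≤ p →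
      ∣ total F ∣ ℕ.≤ bound p (distance p a) (distance p b)
    ∣total∣≤bound {a} {b} F a≤p b≤p with small-or-large b b≤p
    ... | inj₁ (2b≤p , eq) rewrite eq = bounded₃ F a≤p 2b≤p
    ... | inj₂ (h , eq)
      -- The second step is reversed by conjugating `reflect` with `transpose`; none of the three
      -- moves changes the absolute value of the total.
      rewrite eq | sym (total-transpose F) | sym (∣total-reflect∣ (transpose F) b≤p)
            | sym (total-transpose (reflect (transpose F) b≤p)) =
      bounded₃ (transpose (reflect (transpose F) b≤p)) a≤p h

-- The representation m = qr t + pr y + pq z and its behaviour under subtraction of q and r.

module LatticeCoordinates where
  open Squares
  open ResidueCounting
  open Families
  open import Data.Integer.Base hiding (sign; Positive; Negative; _⊓_; _⊔_)
  open import Data.Integer.Properties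
  open import Data.Integer.DivMod using (_%ℕ_; _/ℕ_; n%ℕd<d; a≡a%ℕn+[a/ℕn]*n)
  open import Data.Integer.Divisibility.Signed using (_∣_; divides; ∣⇒∣ᵤ)
  open import Data.Integer.Solver using (module +-*-Solver)
  open +-*-Solver using (solve; _:+_; _:-_; :-_; _:*_; _:=_; con)
  open import Data.Nat.Base as ℕ using (ℕ; zero; suc; _∸_; _⊔_)
  import Data.Nat.Properties as ℕ
  import Data.Nat.Divisibility as ℕ
  open import Data.Product.Base using (_×_; _,_; ∃)
  open import Relation.Nullary.Decidable using (yes; no)
  open import Relation.Nullary.Negation using (contradiction)
  open import Relation.Binary.PropositionalEquality

  residue-unique : ∀ {n i j} → i ℕ.< n → j ℕ.< n → + n ∣ + i - + j → i ≡ j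
  residue-unique {n} {i} {j} i<n j<n n∣i-j with ∣ + i - + j ∣ in eq
  ... | zero  = +-injective (i-j≡0⇒i≡j (+ i) (+ j) (∣i∣≡0⇒i≡0 eq))
  ... | suc k = contradiction
    (ℕ.≤-<-trans (subst (ℕ._≤ i ℕ.⊔ j) (trans (cong ∣_∣ (sym (m-n≡m⊖n i j))) eq) (∣m⊝n∣≤m⊔n i j))
      (ℕ.⊔-lub i<n j<n))
    (ℕ.≤⇒≯ (ℕ.∣⇒≤ (subst (n ℕ.∣_) eq (∣⇒∣ᵤ n∣i-j))))

  lattice : (P Q R t y z : ℤ) → ℤ
  lattice P Q R t y z = Q * R * t + P * R * y + P * Q * z

  lattice-- : ∀ P Q R t y z t′ y′ z′ →
    lattice P Q R (t - t′) (y - y′) (z - z′) ≡ lattice P Q R t y z - lattice P Q R t′ y′ z′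
  lattice-- = solve 9 (λ P Q R t y z t′ y′ z′ →
    Q :* R :* (t :- t′) :+ P :* R :* (y :- y′) :+ P :* Q :* (z :- z′) :=
    (Q :* R :* t :+ P :* R :* y :+ P :* Q :* z) :-
    (Q :* R :* t′ :+ P :* R :* y′ :+ P :* Q :* z′)) refl

  lattice-transpose : ∀ P Q R t y z → lattice P R Q t z y ≡ lattice P Q R t y z
  lattice-transpose = solve 6 (λ P Q R t y z →
    R :* Q :* t :+ P :* Q :* z :+ P :* R :* y := Q :* R :* t :+ P :* R :* y :+ P :* Q :* z) refl

  -- When Q Q′ - P S = 1, the left side is m - R. This is where the step -q' comes from: t drops by
  -- Q′ while y grows by S.
  lattice-R-shift : ∀ P Q R Q′ S t y z →
    lattice P Q R t y z - R * (Q * Q′ - P * S) ≡ lattice P Q R (t - Q′) (y + S) z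
  lattice-R-shift = solve 8 (λ P Q R Q′ S t y z →
    Q :* R :* t :+ P :* R :* y :+ P :* Q :* z :- R :* (Q :* Q′ :- P :* S) :=
    Q :* R :* (t :- Q′) :+ P :* R :* (y :+ S) :+ P :* Q :* z) refl

  -- Reducing an overflowing y by Q costs PRQ, which is P units of t; hence the second value P - a
  -- of a step.
  lattice-carry : ∀ P Q R t a y z →
    lattice P Q R (t - a) y z ≡ lattice P Q R (t + (P - a)) (y - Q) z
  lattice-carry = solve 7 (λ P Q R t a y z →
    Q :* R :* (t :- a) :+ P :* R :* y :+ P :* Q :* z :=
    Q :* R :* (t :+ (P :- a)) :+ P :* R :* (y :- Q) :+ P :* Q :* z) refl

  -- The error term p²su of the product of the two inverses is spread over pr and pq by qX + rY = 1.
  lattice-combination : ∀ P Q R Q′ R′ S U m X Y → Q * X + R * Y ≡ 1ℤ →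
    (Q * Q′ - P * S) * (R * R′ - P * U) * m ≡
    lattice P Q R (Q′ * R′ * m) ((P * S * U * Y - S * R′) * m) ((P * S * U * X - Q′ * U) * m)
  lattice-combination P Q R Q′ R′ S U m X Y bezout = begin
    (Q * Q′ - P * S) * (R * R′ - P * U) * m
      ≡⟨ solve 8 (λ P Q R Q′ R′ S U m →
           (Q :* Q′ :- P :* S) :* (R :* R′ :- P :* U) :* m :=
           (Q :* R :* Q′ :* R′ :- P :* R :* S :* R′ :- P :* Q :* Q′ :* U
             :+ P :* P :* S :* U :* con 1ℤ) :* m) refl P Q R Q′ R′ S U m ⟩
    (Q * R * Q′ * R′ - P * R * S * R′ - P * Q * Q′ * U + P * P * S * U * 1ℤ) * m
      ≡⟨ cong (λ x → (Q * R * Q′ * R′ - P * R * S * R′ - P * Q * Q′ * U + P * P * S * U * x) * m)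
           bezout ⟨
    (Q * R * Q′ * R′ - P * R * S * R′ - P * Q * Q′ * U + P * P * S * U * (Q * X + R * Y)) * m
      ≡⟨ solve 10 (λ P Q R Q′ R′ S U X Y m →
           (Q :* R :* Q′ :* R′ :- P :* R :* S :* R′ :- P :* Q :* Q′ :* U
             :+ P :* P :* S :* U :* (Q :* X :+ R :* Y)) :* m :=
           Q :* R :* (Q′ :* R′ :* m) :+ P :* R :* ((P :* S :* U :* Y :- S :* R′) :* m)
             :+ P :* Q :* ((P :* S :* U :* X :- Q′ :* U) :* m)) refl P Q R Q′ R′ S U X Y m ⟩
    lattice P Q R (Q′ * R′ * m) ((P * S * U * Y - S * R′) * m) ((P * S * U * X - Q′ * U) * m) ∎
    where open ≡-Reasoning

  lattice-reduce : ∀ P Q R t y z k l →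
    lattice P Q R t (y + k * Q) (z + l * R) ≡ lattice P Q R (t + P * (k + l)) y z
  lattice-reduce = solve 8 (λ P Q R t y z k l →
    Q :* R :* t :+ P :* R :* (y :+ k :* Q) :+ P :* Q :* (z :+ l :* R) :=
    Q :* R :* (t :+ P :* (k :+ l)) :+ P :* R :* y :+ P :* Q :* z) refl

  lattice-00 : ∀ P Q R t y z → lattice P Q R t (y - y) (z - z) ≡ R * (Q * t)
  lattice-00 = solve 6 (λ P Q R t y z →
    Q :* R :* t :+ P :* R :* (y :- y) :+ P :* Q :* (z :- z) := R :* (Q :* t)) refl

  module _ {P Q R Q′ S X Y : ℤ} (QQ′ : Q * Q′ ≡ 1ℤ + P * S) (bezout : Q * X + R * Y ≡ 1ℤ) where

    -- Modulo `Q` the form reduces to `P * R * y`, where `- S` inverts `P` and `Y` inverts `R`;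
    -- multiplying by `- (S * Y)` therefore recovers `y`.
    lattice-zero⇒∣ : ∀ t y z → lattice P Q R t y z ≡ 0ℤ → Q ∣ y
    lattice-zero⇒∣ t y z eq = divides
      (y * (Q′ * (Q * X + R * Y) - P * S * X) + S * Y * (R * t + P * z)) (begin
        y
          ≡⟨ solve 2 (λ y k → y := y :* (con 1ℤ :+ k :- k) :* con 1ℤ) refl y (P * S) ⟩
        y * (1ℤ + P * S - P * S) * 1ℤ
          ≡⟨ cong₂ (λ x w → y * (x - P * S) * w) (sym QQ′) (sym bezout) ⟩
        y * (Q * Q′ - P * S) * (Q * X + R * Y)
          ≡⟨ solve 10 (λ P Q R Q′ S X Y t y z →
               y :* (Q :* Q′ :- P :* S) :* (Q :* X :+ R :* Y) :=
               (y :* (Q′ :* (Q :* X :+ R :* Y) :- P :* S :* X) :+ S :* Y :* (R :* t :+ P :* z)) :* Q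
                 :- S :* Y :* (Q :* R :* t :+ P :* R :* y :+ P :* Q :* z))
               refl P Q R Q′ S X Y t y z ⟩
        k * Q - S * Y * lattice P Q R t y z
          ≡⟨ cong (λ x → k * Q - S * Y * x) eq ⟩
        k * Q - S * Y * 0ℤ
          ≡⟨ solve 2 (λ x y → x :- y :* con 0ℤ := x) refl (k * Q) (S * Y) ⟩
        k * Q ∎)
      where
      open ≡-Reasoning
      k = y * (Q′ * (Q * X + R * Y) - P * S * X) + S * Y * (R * t + P * z)

  record Coordinates (p q r : ℕ) (m : ℤ) : Set where
    constructor coordinates
    field
      t   : ℤ
      y z : ℕ
      y<q : y ℕ.< q
      z<r : z ℕ.< r
      eq  : m ≡ lattice (+ p) (+ q) (+ r) t (+ y) (+ z)

  -- Here q - s and r - u are the inverses of p modulo q and modulo r.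
  record Inverses (p q r q′ r′ : ℕ) : Set where
    field
      s u    : ℕ
      X Y    : ℤ
      qq′    : q ℕ.* q′ ≡ 1 ℕ.+ p ℕ.* s
      rr′    : r ℕ.* r′ ≡ 1 ℕ.+ p ℕ.* u
      bezout : + q * X + + r * Y ≡ 1ℤ
      q≢0    : ℕ.NonZero q
      r≢0    : ℕ.NonZero r
      2≤p    : 2 ℕ.≤ p
      p<q    : p ℕ.< q
      p<r    : p ℕ.< r
      s<q    : s ℕ.< q
      u<r    : u ℕ.< r

  module Lattice {p q r q′ r′} (inverses : Inverses p q r q′ r′) where
    open Inverses inverses

    P = + p
    Q = + q
    R = + r

    instance
      _ = q≢0
      _ = r≢0

    QQ′ : Q * + q′ ≡ 1ℤ + P * + s
    QQ′ = trans (sym (pos-* q q′)) (trans (cong +_ qq′) (cong (λ x → 1ℤ + x) (pos-* p s)))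

    RR′ : R * + r′ ≡ 1ℤ + P * + u
    RR′ = trans (sym (pos-* r r′)) (trans (cong +_ rr′) (cong (λ x → 1ℤ + x) (pos-* p u)))

    private
      cancel : ∀ {x y} → x ≡ 1ℤ + y → x - y ≡ 1ℤ
      cancel {y = y} refl = solve 1 (λ y → con 1ℤ :+ y :- y := con 1ℤ) refl y

    abstract
      -- m is multiplied by (q q′ - p s)(r r′ - p u) = 1 and expanded; the quotients of the last two
      -- coefficients by q and r are then absorbed into t as multiples of p. It is abstract because
      -- later arguments rely on the recorded properties and on uniqueness, never on these formulas.
      coordinates-of : ∀ m → Coordinates p q r m
      coordinates-of m = coordinates (+ q′ * + r′ * m + P * (k + l)) (B %ℕ q) (C %ℕ r)
        (n%ℕd<d B q) (n%ℕd<d C r) (begin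
          m
            ≡⟨ sym (*-identityˡ m) ⟩
          1ℤ * 1ℤ * m
            ≡⟨ cong₂ (λ x w → x * w * m) (cancel QQ′) (cancel RR′) ⟨
          (Q * + q′ - P * + s) * (R * + r′ - P * + u) * m
            ≡⟨ lattice-combination P Q R (+ q′) (+ r′) (+ s) (+ u) m X Y bezout ⟩
          lattice P Q R (+ q′ * + r′ * m) B C
            ≡⟨ cong₂ (lattice P Q R (+ q′ * + r′ * m))
                 (a≡a%ℕn+[a/ℕn]*n B q) (a≡a%ℕn+[a/ℕn]*n C r) ⟩
          lattice P Q R (+ q′ * + r′ * m) (+ (B %ℕ q) + k * Q) (+ (C %ℕ r) + l * R)
            ≡⟨ lattice-reduce P Q R (+ q′ * + r′ * m) (+ (B %ℕ q)) (+ (C %ℕ r)) k l ⟩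
          lattice P Q R (+ q′ * + r′ * m + P * (k + l)) (+ (B %ℕ q)) (+ (C %ℕ r)) ∎)
        where
        open ≡-Reasoning
        B C k l : ℤ
        B = (P * + s * + u * Y - + s * + r′) * m
        C = (P * + s * + u * X - + q′ * + u) * m
        k = B /ℕ q
        l = C /ℕ r

    module _ {m : ℤ} (c c′ : Coordinates p q r m) where
      private
        module c = Coordinates c
        module c′ = Coordinates c′

        difference : lattice P Q R (c.t - c′.t) (+ c.y - + c′.y) (+ c.z - + c′.z) ≡ 0ℤ
        difference = trans (lattice-- P Q R c.t (+ c.y) (+ c.z) c′.t (+ c′.y) (+ c′.z))
          (i≡j⇒i-j≡0
            (trans (sym c.eq) c′.eq))

      y-unique : c.y ≡ c′.y
      y-unique = residue-unique c.y<q c′.y<q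
        (lattice-zero⇒∣ {P} {Q} {R} QQ′ bezout (c.t - c′.t) (+ c.y - + c′.y) (+ c.z - + c′.z) difference)

      z-unique : c.z ≡ c′.z
      z-unique = residue-unique c.z<r c′.z<r
        (lattice-zero⇒∣ {P} {R} {Q} RR′ (trans (+-comm (R * Y) (Q * X)) bezout)
          (c.t - c′.t) (+ c.z - + c′.z) (+ c.y - + c′.y)
          (trans (lattice-transpose P Q R (c.t - c′.t) (+ c.y - + c′.y) (+ c.z - + c′.z)) difference))

      t-unique : c.t ≡ c′.t
      t-unique = i-j≡0⇒i≡j c.t c′.t
        (*-cancelˡ-≡ Q (c.t - c′.t) 0ℤ (*-cancelˡ-≡ R (Q * (c.t - c′.t)) (Q * 0ℤ) (begin
          R * (Q * (c.t - c′.t))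
            ≡⟨ lattice-00 P Q R (c.t - c′.t) (+ c.y) (+ c.z) ⟨
          lattice P Q R (c.t - c′.t) (+ c.y - + c.y) (+ c.z - + c.z)
            ≡⟨ cong₂ (λ y z → lattice P Q R (c.t - c′.t) (+ c.y - + y) (+ c.z - + z)) y-unique z-unique ⟩
          lattice P Q R (c.t - c′.t) (+ c.y - + c′.y) (+ c.z - + c′.z)
            ≡⟨ difference ⟩
          0ℤ
            ≡⟨ trans (cong (R *_) (*-zeroʳ Q)) (*-zeroʳ R) ⟨
          R * (Q * 0ℤ) ∎)))
        where open ≡-Reasoning

    τ : ℤ → ℤ
    τ m = Coordinates.t (coordinates-of m)
    y-of z-of : ℤ → ℕ
    y-of m = Coordinates.y (coordinates-of m)
    z-of m = Coordinates.z (coordinates-of m)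

    private
      -- The carry of adding `k` to the coordinate `y` modulo `n`: an overflow adds p to the change
      -- -n′ of t.
      step : ℕ → ℕ → ℕ → ℕ → ℤ
      step n n′ k y with y ℕ.+ k ℕ.<? n
      ... | yes _ = - + n′
      ... | no _  = P - + n′

      step-shift : ∀ n n′ k y → Shift P (+ n′) (step n n′ k y)
      step-shift n n′ k y with y ℕ.+ k ℕ.<? n
      ... | yes _ = down
      ... | no _  = up

      wrap : ∀ {n y k} → y ℕ.< n → k ℕ.< n → y ℕ.+ k ℕ.≮ n → y ℕ.+ k ∸ n ℕ.< n
      wrap {n} y<n k<n ≮n = ℕ.+-cancelʳ-< n _ n
        (subst (ℕ._< n ℕ.+ n) (sym (ℕ.m∸n+n≡m (ℕ.≮⇒≥ ≮n))) (ℕ.+-mono-< y<n k<n))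

      R-shift : ∀ t y z {m} → m ≡ lattice P Q R t y z →
        m - R ≡ lattice P Q R (t - + q′) (y + + s) z
      R-shift t y z {m} eq = trans
        (cong₂ _-_ eq (sym (trans (cong (R *_) (cancel QQ′)) (*-identityʳ R))))
        (lattice-R-shift P Q R (+ q′) (+ s) t y z)

      Q-shift : ∀ t y z {m} → m ≡ lattice P Q R t y z →
        m - Q ≡ lattice P Q R (t - + r′) y (z + + u)
      Q-shift t y z {m} eq = trans
        (cong₂ _-_ (trans eq (sym (lattice-transpose P Q R t y z)))
          (sym (trans (cong (Q *_) (cancel RR′)) (*-identityʳ Q))))
        (trans (lattice-R-shift P R Q (+ r′) (+ u) t z y)
          (lattice-transpose P Q R (t - + r′) y (z + + u)))

      carry-y : ∀ t a y z → q ℕ.≤ y →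
        lattice P Q R (t - a) (+ y) z ≡ lattice P Q R (t + (P - a)) (+ (y ∸ q)) z
      carry-y t a y z q≤y = trans (lattice-carry P Q R t a (+ y) z)
        (cong (λ w → lattice P Q R (t + (P - a)) w z) (sym (+∸ q≤y)))

      carry-z : ∀ t a y z → r ℕ.≤ z →
        lattice P Q R (t - a) y (+ z) ≡ lattice P Q R (t + (P - a)) y (+ (z ∸ r))
      carry-z t a y z r≤z = trans (sym (lattice-transpose P Q R (t - a) y (+ z)))
        (trans (lattice-carry P R Q t a (+ z) y)
          (trans (cong (λ w → lattice P R Q (t + (P - a)) w y) (sym (+∸ r≤z)))
            (lattice-transpose P Q R (t + (P - a)) y (+ (z ∸ r)))))

    r-step q-step : ℤ → ℤ
    r-step m = step q q′ s (y-of m)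
    q-step m = step r r′ u (z-of m)

    r-step-shift : ∀ m → Shift P (+ q′) (r-step m)
    r-step-shift m = step-shift q q′ s (y-of m)

    q-step-shift : ∀ m → Shift P (+ r′) (q-step m)
    q-step-shift m = step-shift r r′ u (z-of m)

    private
      r-coordinates : ∀ m → ∃ λ (c : Coordinates p q r (m - R)) →
        Coordinates.t c ≡ τ m + r-step m × Coordinates.z c ≡ z-of m
      r-coordinates m with coordinates-of m
      ... | coordinates t y z y<q z<r eq with y ℕ.+ s ℕ.<? q
      ...   | yes y+s<q =
        coordinates (t + - + q′) (y ℕ.+ s) z y+s<q z<r (R-shift t (+ y) (+ z) eq) , refl , refl
      ...   | no y+s≮q =
        coordinates (t + (P - + q′)) (y ℕ.+ s ∸ q) z (wrap y<q s<q y+s≮q) z<r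
          (trans (R-shift t (+ y) (+ z) eq) (carry-y t (+ q′) (y ℕ.+ s) (+ z) (ℕ.≮⇒≥ y+s≮q))) ,
        refl , refl

      q-coordinates : ∀ m → ∃ λ (c : Coordinates p q r (m - Q)) →
        Coordinates.t c ≡ τ m + q-step m × Coordinates.y c ≡ y-of m
      q-coordinates m with coordinates-of m
      ... | coordinates t y z y<q z<r eq with z ℕ.+ u ℕ.<? r
      ...   | yes z+u<r =
        coordinates (t + - + r′) y (z ℕ.+ u) y<q z+u<r (Q-shift t (+ y) (+ z) eq) , refl , refl
      ...   | no z+u≮r =
        coordinates (t + (P - + r′)) y (z ℕ.+ u ∸ r) y<q (wrap z<r u<r z+u≮r)
          (trans (Q-shift t (+ y) (+ z) eq) (carry-z t (+ r′) (+ y) (z ℕ.+ u) (ℕ.≮⇒≥ z+u≮r))) ,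
        refl , refl

    τ-R : ∀ m → τ (m - R) ≡ τ m + r-step m
    τ-R m with c , t≡ , _ ← r-coordinates m = trans (t-unique (coordinates-of (m - R)) c) t≡

    τ-Q : ∀ m → τ (m - Q) ≡ τ m + q-step m
    τ-Q m with c , t≡ , _ ← q-coordinates m = trans (t-unique (coordinates-of (m - Q)) c) t≡

    -- Subtracting q alters only t and z, so y and the carry read off from it stay the same.
    -- Opposite edges of the square are therefore equal.
    r-step-Q : ∀ m → r-step (m - Q) ≡ r-step m
    r-step-Q m with c , _ , y≡ ← q-coordinates m =
      cong (step q q′ s) (trans (y-unique (coordinates-of (m - Q)) c) y≡)

    τ-Q-R : ∀ m → τ (m - Q - R) ≡ τ m + r-step m + q-step m
    τ-Q-R m = trans (τ-R (m - Q)) (trans (cong₂ _+_ (τ-Q m) (r-step-Q m))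
      (solve 3 (λ t d e → t :+ e :+ d := t :+ d :+ e) refl (τ m) (r-step m) (q-step m)))

-- From lattice coordinates to a bounded coefficient sum.

module CoefficientSums where
  open Squares
  open ResidueCounting
  open Families
  open LatticeCoordinates
  open import Data.Integer.Base hiding (sign; Positive; Negative; _⊓_; _⊔_; _/_; suc)
  open import Data.Integer.Properties
  open import Data.Integer.Divisibility.Signed using (_∣_; divides)
  open import Data.Integer.Solver using (module +-*-Solver)
  open +-*-Solver using (solve; _:+_; _:-_; :-_; _:*_; _:=_; con)
  open import Data.Nat.Base as ℕ using (ℕ; suc)
  import Data.Nat.Properties as ℕ
  import Data.Nat.DivMod as ℕ
  open import Data.Product.Base using (_,_)
  open import Relation.Nullary.Negation using (contradiction)
  open import Relation.Binary.PropositionalEquality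

  -- On generating functions this is multiplication by x^d - 1.
  Δ : ℤ → (ℤ → ℤ) → ℤ → ℤ
  Δ d f m = f (m - d) - f m

  0≤* : ∀ {i j} → 0ℤ ≤ i → 0ℤ ≤ j → 0ℤ ≤ i * j
  0≤* {+ m} {+ n} _ _ = subst (0ℤ ≤_) (pos-* m n) (+≤+ ℕ.z≤n)

  lattice-lower : ∀ P Q R t y z → lattice P Q R t y z - Q * R * t ≡ P * R * y + P * Q * z
  lattice-lower = solve 6 (λ P Q R t y z →
    Q :* R :* t :+ P :* R :* y :+ P :* Q :* z :- Q :* R :* t := P :* R :* y :+ P :* Q :* z) refl

  -- The right side is nonnegative as y < Q and z < R; the surplus P R + P Q gained from strictness
  -- is the room for displacing the argument by up to j + q + r.
  lattice-upper : ∀ P Q R t y z →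
    Q * R * (t + P + P) - (lattice P Q R t y z + (P * R + P * Q)) ≡
    P * R * (Q - (1ℤ + y)) + P * Q * (R - (1ℤ + z))
  lattice-upper = solve 6 (λ P Q R t y z →
    Q :* R :* (t :+ P :+ P) :-
      (Q :* R :* t :+ P :* R :* y :+ P :* Q :* z :+ (P :* R :+ P :* Q)) :=
    P :* R :* (Q :- (con 1ℤ :+ y)) :+ P :* Q :* (R :- (con 1ℤ :+ z))) refl

  lattice-mod : ∀ P Q R t y z t′ y′ z′ → lattice P Q R t y z - lattice P Q R t′ y′ z′ ≡
    Q * R * (t - t′) + P * (R * (y - y′) + Q * (z - z′))
  lattice-mod = solve 9 (λ P Q R t y z t′ y′ z′ →
    (Q :* R :* t :+ P :* R :* y :+ P :* Q :* z) :-
    (Q :* R :* t′ :+ P :* R :* y′ :+ P :* Q :* z′) :=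
    Q :* R :* (t :- t′) :+ P :* (R :* (y :- y′) :+ Q :* (z :- z′))) refl

  module Bounded {p q r q′ r′} (inverses : Inverses p q r q′ r′) where
    open Inverses inverses
    open Lattice inverses

    χ : ℤ → ℤ
    χ m = nonneg (τ m)

    QR*τ≤ : ∀ m → Q * R * τ m ≤ m
    QR*τ≤ m = 0≤i-j⇒j≤i (subst (λ x → 0ℤ ≤ x - Q * R * τ m) (sym eq)
      (≥0-resp (sym (lattice-lower P Q R (τ m) (+ y-of m) (+ z-of m)))
        (0≤* (0≤* {P} {R} (+≤+ ℕ.z≤n) (+≤+ ℕ.z≤n)) (+≤+ ℕ.z≤n) ⊕
         0≤* (0≤* {P} {Q} (+≤+ ℕ.z≤n) (+≤+ ℕ.z≤n)) (+≤+ ℕ.z≤n))))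
      where
      open Coordinates (coordinates-of m) using (eq)

    ≤QR*[τ+2P] : ∀ m → m + (P * R + P * Q) ≤ Q * R * (τ m + P + P)
    ≤QR*[τ+2P] m = 0≤i-j⇒j≤i (subst (λ x → 0ℤ ≤ Q * R * (τ m + P + P) - (x + (P * R + P * Q))) (sym eq)
      (≥0-resp (sym (lattice-upper P Q R (τ m) (+ y-of m) (+ z-of m)))
        (0≤* (0≤* {P} {R} (+≤+ ℕ.z≤n) (+≤+ ℕ.z≤n)) (≤⇒0≤- y<q) ⊕
         0≤* (0≤* {P} {Q} (+≤+ ℕ.z≤n) (+≤+ ℕ.z≤n)) (≤⇒0≤- z<r))))
      where
      open Coordinates (coordinates-of m) using (eq; y<q; z<r)

    private
      instance
        qr-nonNegative : NonNegative (Q * R)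
        qr-nonNegative = nonNegative (0≤* {Q} {R} (+≤+ ℕ.z≤n) (+≤+ ℕ.z≤n))

    χ-negative : ∀ m → m < 0ℤ → χ m ≡ 0ℤ
    χ-negative m m<0 with sign (τ m)
    ... | is<0 _ eq  = eq
    ... | is≥0 0≤τ _ = contradiction
      (≤-<-trans (≤-trans (0≤* {Q * R} (nonNegative⁻¹ (Q * R)) 0≤τ) (QR*τ≤ m)) m<0) (<-irrefl refl)

    χ-square : ∀ m → Δ Q (Δ R χ) m ≡ square (τ m) (r-step m) (q-step m)
    χ-square m = trans
      (solve 4 (λ x y z w → w :- z :- (y :- x) := x :- y :- z :+ w) refl
        (χ m) (χ (m - R)) (χ (m - Q)) (χ (m - Q - R)))
      (sym (square-value (τ m) (r-step m) (q-step m) refl (cong nonneg (sym (τ-R m)))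
        (cong nonneg (sym (τ-Q m))) (cong nonneg (sym (τ-Q-R m)))))

    τ<p : ∀ m → m < P * Q * R → τ m < P
    τ<p m m<pqr = *-cancelˡ-<-nonNeg (Q * R) (begin-strict
      Q * R * τ m ≤⟨ QR*τ≤ m ⟩
      m           <⟨ m<pqr ⟩
      P * Q * R   ≡⟨ solve 3 (λ P Q R → P :* Q :* R := Q :* R :* P) refl P Q R ⟩
      Q * R * P   ∎)
      where open ≤-Reasoning

    module _ (n : ℕ) where
      private
        instance
          qr≢0 : ℕ.NonZero (q ℕ.* r)
          qr≢0 = ℕ.m*n≢0 q r {{q≢0}} {{r≢0}}

        θ : ℕ
        θ = n ℕ./ (q ℕ.* r)

        QR*θ≤n : Q * R * + θ ≤ + n
        QR*θ≤n = subst (_≤ + n) (trans (pos-* (q ℕ.* r) θ) (cong (_* + θ) (pos-* q r)))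
          (+≤+ (subst (ℕ._≤ n) (ℕ.*-comm θ (q ℕ.* r)) (ℕ.m/n*n≤m n (q ℕ.* r))))

        n<QR*[1+θ] : + n < Q * R * + suc θ
        n<QR*[1+θ] = subst (+ n <_)
          (trans (pos-* (q ℕ.* r) (suc θ)) (cong (_* + suc θ) (pos-* q r)))
          (+<+ (subst (n ℕ.<_) (ℕ.*-comm (suc θ) (q ℕ.* r)) (subst (ℕ._< suc θ ℕ.* (q ℕ.* r))
            (sym (ℕ.m≡m%n+[m/n]*n n (q ℕ.* r))) (ℕ.+-monoˡ-< (θ ℕ.* (q ℕ.* r)) (ℕ.m%n<n n (q ℕ.* r))))))

        window : ∀ k → k ℕ.< p ℕ.* r ℕ.+ p ℕ.* q → Window P (+ θ) (τ (+ n - + k))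
        window k k< = i≤j⇒0≤j-i (suc-≤⁻¹ upper) , ≥0-resp eq (i≤j⇒0≤j-i (i<j⇒suc[i]≤j lower))
          where
          open ≤-Reasoning
          m = + n - + k
          suc-≤⁻¹ : ∀ {i} → i < + suc θ → i ≤ + θ
          suc-≤⁻¹ (-<+)               = -≤+
          suc-≤⁻¹ (+<+ (ℕ.s≤s i≤θ)) = +≤+ i≤θ
          upper : τ m < + suc θ
          upper = *-cancelˡ-<-nonNeg (Q * R) (begin-strict
            Q * R * τ m     ≤⟨ QR*τ≤ m ⟩
            + n - + k       ≤⟨ i≤j⇒i-k≤j (+ k) ≤-refl ⟩
            + n             <⟨ n<QR*[1+θ] ⟩
            Q * R * + suc θ ∎)
          lower : + θ < τ m + P + P
          lower = *-cancelˡ-<-nonNeg (Q * R) (begin-strict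
            Q * R * + θ             ≤⟨ QR*θ≤n ⟩
            + n                     ≡⟨ solve 2 (λ n k → n := n :- k :+ k) refl (+ n) (+ k) ⟩
            m + + k                 <⟨ +-monoʳ-< m (subst (+ k <_)
                                         (cong₂ _+_ (pos-* p r) (pos-* p q)) (+<+ k<)) ⟩
            m + (P * R + P * Q)     ≤⟨ ≤QR*[τ+2P] m ⟩
            Q * R * (τ m + P + P)   ∎)
          eq : τ m + P + P - (1ℤ + + θ) ≡ τ m + P + P - 1ℤ - + θ
          eq = solve 2 (λ x θ → x :- (con 1ℤ :+ θ) := x :- con 1ℤ :- θ) refl (τ m + P + P) (+ θ)

        -- The largest displacement fits into the available room: j < p < r, so it is below 2r + 2q,
        -- and p is at least 2.
        small : ∀ j → j ℕ.< p → j ℕ.+ q ℕ.+ r ℕ.< p ℕ.* r ℕ.+ p ℕ.* q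
        small j j<p = begin-strict
          j ℕ.+ q ℕ.+ r           <⟨ ℕ.+-monoˡ-< r (ℕ.+-monoˡ-< q (ℕ.<-trans j<p p<r)) ⟩
          r ℕ.+ q ℕ.+ r           ≤⟨ ℕ.m≤m+n (r ℕ.+ q ℕ.+ r) q ⟩
          r ℕ.+ q ℕ.+ r ℕ.+ q     ≡⟨ rearrange ⟩
          2 ℕ.* r ℕ.+ 2 ℕ.* q     ≤⟨ ℕ.+-mono-≤ (ℕ.*-monoˡ-≤ r 2≤p) (ℕ.*-monoˡ-≤ q 2≤p) ⟩
          p ℕ.* r ℕ.+ p ℕ.* q     ∎
          where
          open ℕ.≤-Reasoning
          rearrange : r ℕ.+ q ℕ.+ r ℕ.+ q ≡ 2 ℕ.* r ℕ.+ 2 ℕ.* q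
          rearrange rewrite ℕ.+-identityʳ r | ℕ.+-identityʳ q | ℕ.+-assoc r q r | ℕ.+-comm q r =
            trans (ℕ.+-assoc r (r ℕ.+ q) q)
              (trans (cong (r ℕ.+_) (ℕ.+-assoc r q q)) (sym (ℕ.+-assoc r r (q ℕ.+ q))))

        m : ℕ → ℤ
        m j = + n - + j

        shifted : ∀ j k → + n - + j - + k ≡ + n - + (j ℕ.+ k)
        shifted j k = solve 3 (λ n j k → n :- j :- k := n :- (j :+ k)) refl (+ n) (+ j) (+ k)

        -- Modulo p the representation reads n - j ≡ qr t(n - j), so congruent values of t force
        -- congruent, hence equal, indices.
        distinct-τ : Distinct p (λ j → τ (m j))
        distinct-τ i j i<p j<p (divides k eq) = sym (residue-unique j<p i<p (divides
          (Q * R * k + (R * (+ ci.y - + cj.y) + Q * (+ ci.z - + cj.z))) (begin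
          + j - + i
            ≡⟨ solve 3 (λ n i j → j :- i := n :- i :- (n :- j)) refl (+ n) (+ i) (+ j) ⟩
          m i - m j
            ≡⟨ cong₂ _-_ ci.eq cj.eq ⟩
          lattice P Q R ci.t (+ ci.y) (+ ci.z) - lattice P Q R cj.t (+ cj.y) (+ cj.z)
            ≡⟨ lattice-mod P Q R ci.t (+ ci.y) (+ ci.z) cj.t (+ cj.y) (+ cj.z) ⟩
          Q * R * (ci.t - cj.t) + P * w
            ≡⟨ cong (λ x → Q * R * x + P * w) eq ⟩
          Q * R * (k * P) + P * w
            ≡⟨ solve 4 (λ P x k w → x :* (k :* P) :+ P :* w := (x :* k :+ w) :* P) refl P (Q * R) k w ⟩
          (Q * R * k + w) * P ∎)))
          where
          open ≡-Reasoning
          module ci = Coordinates (coordinates-of (m i))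
          module cj = Coordinates (coordinates-of (m j))
          w = R * (+ ci.y - + cj.y) + Q * (+ ci.z - + cj.z)

        family : Family p (+ θ) q′ r′
        family = record
          { t = λ j → τ (m j) ; d = λ j → r-step (m j) ; e = λ j → q-step (m j)
          ; shift₁ = λ j → r-step-shift (m j)
          ; shift₂ = λ j → q-step-shift (m j)
          ; window₀ = λ j j<p → window j
              (ℕ.≤-<-trans (ℕ.≤-trans (ℕ.m≤m+n j q) (ℕ.m≤m+n (j ℕ.+ q) r)) (small j j<p))
          ; window₁ = λ j j<p → subst (Window P (+ θ))
              (trans (cong τ (sym (shifted j r))) (τ-R (m j)))
              (window (j ℕ.+ r) (ℕ.≤-<-trans (ℕ.+-monoˡ-≤ r (ℕ.m≤m+n j q)) (small j j<p)))
          ; window₂ = λ j j<p → subst (Window P (+ θ))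
              (trans (cong τ (sym (shifted j q))) (τ-Q (m j)))
              (window (j ℕ.+ q) (ℕ.≤-<-trans (ℕ.m≤m+n (j ℕ.+ q) r) (small j j<p)))
          ; window₁₂ = λ j j<p → subst (Window P (+ θ))
              (trans (cong τ (sym (trans (cong (_- R) (shifted j q)) (shifted (j ℕ.+ q) r))))
                (τ-Q-R (m j)))
              (window (j ℕ.+ q ℕ.+ r) (small j j<p))
          ; distinct = distinct-τ
          }

      sum-bounded : n ℕ.< p ℕ.* q ℕ.* r → q′ ℕ.≤ p → r′ ℕ.≤ p →
        ∣ sum< p (λ j → Δ Q (Δ R χ) (+ n - + j)) ∣ ℕ.≤ bound p (distance p q′) (distance p r′)
      sum-bounded n<pqr q′≤p r′≤p =
        subst (λ x → ∣ x ∣ ℕ.≤ bound p (distance p q′) (distance p r′))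
          (sym (sum<-cong p (λ j → χ-square (m j))))
          (∣total∣≤bound hθ family q′≤p r′≤p)
        where
        θ<p : θ ℕ.< p
        θ<p = ℕ.m<n*o⇒m/o<n (subst (n ℕ.<_) (ℕ.*-assoc p q r) n<pqr)
        hθ : 0ℤ ≤ P - 1ℤ - + θ
        hθ = ≥0-resp (solve 2 (λ P θ → P :- (con 1ℤ :+ θ) := P :- con 1ℤ :- θ) refl P (+ θ)) (≤⇒0≤- θ<p)

-- The brackets as the series of 1/((1 - x^pq)(1 - x^pr)(1 - x^qr)) below x^pqr.

module GeneratingFunctions where
  open Squares
  open LatticeCoordinates
  open CoefficientSums
  open import Data.Integer.Base hiding (sign; Positive; Negative; _⊓_; _⊔_; _/_; suc)
  open import Data.Integer.Properties
  open import Data.Integer.Solver using (module +-*-Solver)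
  open +-*-Solver using (solve; _:+_; _:-_; :-_; _:*_; _:=_; con)
  open import Data.Nat.Base as ℕ using (ℕ; zero; suc)
  import Data.Nat.Properties as ℕ
  open import Relation.Nullary.Negation using (contradiction)
  open import Relation.Binary.PropositionalEquality

  isZero : ℕ → ℤ
  isZero zero    = 1ℤ
  isZero (suc _) = 0ℤ

  δ : ℤ → ℤ
  δ (+ n)    = isZero n
  δ -[1+ _ ] = 0ℤ

  lattice-z-1 : ∀ P Q R t y z → lattice P Q R t y (1ℤ + z) - P * Q ≡ lattice P Q R t y z
  lattice-z-1 = solve 6 (λ P Q R t y z →
    Q :* R :* t :+ P :* R :* y :+ P :* Q :* (con 1ℤ :+ z) :- P :* Q :=
    Q :* R :* t :+ P :* R :* y :+ P :* Q :* z) refl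

  lattice-z-borrow : ∀ P Q R t y → lattice P Q R t y 0ℤ - P * Q ≡ lattice P Q R (t - P) y (R - 1ℤ)
  lattice-z-borrow = solve 5 (λ P Q R t y →
    Q :* R :* t :+ P :* R :* y :+ P :* Q :* con 0ℤ :- P :* Q :=
    Q :* R :* (t :- P) :+ P :* R :* y :+ P :* Q :* (R :- con 1ℤ)) refl

  lattice-t-1 : ∀ P Q R t y z → lattice P Q R t y z - Q * R ≡ lattice P Q R (t - 1ℤ) y z
  lattice-t-1 = solve 6 (λ P Q R t y z →
    Q :* R :* t :+ P :* R :* y :+ P :* Q :* z :- Q :* R :=
    Q :* R :* (t :- con 1ℤ) :+ P :* R :* y :+ P :* Q :* z) refl

  lattice-axis : ∀ P Q R t → lattice P Q R t 0ℤ 0ℤ ≡ Q * R * t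
  lattice-axis = solve 4 (λ P Q R t →
    Q :* R :* t :+ P :* R :* con 0ℤ :+ P :* Q :* con 0ℤ := Q :* R :* t) refl

  nonneg-< : ∀ {t p} → t < p → nonneg (t - p) ≡ 0ℤ
  nonneg-< {t} {p} t<p with sign (t - p)
  ... | is<0 _ eq = eq
  ... | is≥0 h _  = contradiction t<p (≤⇒≯ (0≤i-j⇒j≤i h))

  nonneg-pred : ∀ t → nonneg (t - 1ℤ) - nonneg t ≡ - δ t
  nonneg-pred (+ zero)    = refl
  nonneg-pred (+ suc n)   = refl
  nonneg-pred -[1+ n ]    = refl

  module Generating {p q r q′ r′} (inverses : Inverses p q r q′ r′) where
    open Inverses inverses
    open Lattice inverses
    open Bounded inverses

    private
      -- Below pqr these are the coefficients of 1/((1 - x^pr)(1 - x^qr)) and of 1/(1 - x^qr): one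
      -- denominator at a time is removed from `χ`.
      χz χyz : ℤ → ℤ
      χz  m = isZero (z-of m) * χ m
      χyz m = isZero (y-of m) * χz m

      module _ {m} (c : Coordinates p q r m) where
        open Coordinates c

        τ≡ : τ m ≡ t
        τ≡ = t-unique (coordinates-of m) c

        y≡ : y-of m ≡ y
        y≡ = y-unique (coordinates-of m) c

        z≡ : z-of m ≡ z
        z≡ = z-unique (coordinates-of m) c

      same : ∀ x y → x ≡ y → x - y ≡ - (0ℤ * y)
      same x y refl = solve 1 (λ x → x :- x := :- (con 0ℤ :* x)) refl x

      lost : ∀ x y → x ≡ 0ℤ → x - y ≡ - (1ℤ * y)
      lost x y refl = solve 1 (λ y → con 0ℤ :- y := :- (con 1ℤ :* y)) refl y

      pred-eq : ∀ n → .{{_ : ℕ.NonZero n}} → + n - 1ℤ ≡ + ℕ.pred n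
      pred-eq (suc n) = refl

      pred-< : ∀ n → .{{_ : ℕ.NonZero n}} → ℕ.pred n ℕ.< n
      pred-< (suc n) = ℕ.≤-refl

      -- Subtracting pq lowers z and keeps t, so the brackets cancel unless z = 0. Then a borrow
      -- turns t into t - p, which is negative because m < pqr forces t < p.
      Δχ-at : ∀ {m} → m < P * Q * R → (c : Coordinates p q r m) →
        Δ (P * Q) χ m ≡ - (isZero (Coordinates.z c) * χ m)
      Δχ-at {m} m<N (coordinates t y (suc z) y<q z<r eq) = same (χ (m - P * Q)) (χ m)
        (cong nonneg (trans (τ≡ (coordinates {m = m - P * Q} t y z y<q (ℕ.<-trans ℕ.≤-refl z<r)
          (trans (cong (_- P * Q) eq) (lattice-z-1 P Q R t (+ y) (+ z)))))
          (sym (τ≡ (coordinates t y (suc z) y<q z<r eq)))))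
      Δχ-at {m} m<N c@(coordinates t y zero y<q z<r eq) = lost (χ (m - P * Q)) (χ m)
        (trans (cong nonneg (τ≡ (coordinates {m = m - P * Q} (t - P) y (ℕ.pred r) y<q
            (pred-< r {{r≢0}})
            (trans (cong (_- P * Q) eq) (trans (lattice-z-borrow P Q R t (+ y))
              (cong (lattice P Q R (t - P) (+ y)) (pred-eq r {{r≢0}})))))))
          (nonneg-< (subst (_< P) (τ≡ c) (τ<p m m<N))))

      Δχz-at : ∀ {m} → m < P * Q * R → (c : Coordinates p q r m) →
        Δ (P * R) χz m ≡ - (isZero (Coordinates.y c) * χz m)
      Δχz-at {m} m<N c@(coordinates t (suc y) z y<q z<r eq) = same (χz (m - P * R)) (χz m)
        (cong₂ (λ t z → isZero z * nonneg t)
          (trans (τ≡ c′) (sym (τ≡ c))) (trans (z≡ c′) (sym (z≡ c))))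
        where
        c′ : Coordinates p q r (m - P * R)
        c′ = coordinates t y z (ℕ.<-trans ℕ.≤-refl y<q) z<r
          (trans (cong (_- P * R) (trans eq (sym (lattice-transpose P Q R t (+ suc y) (+ z)))))
            (trans (lattice-z-1 P R Q t (+ z) (+ y)) (lattice-transpose P Q R t (+ y) (+ z))))
      Δχz-at {m} m<N c@(coordinates t zero z y<q z<r eq) = lost (χz (m - P * R)) (χz m)
        (trans (cong (isZero (z-of (m - P * R)) *_)
            (trans (cong nonneg (τ≡ c′)) (nonneg-< (subst (_< P) (τ≡ c) (τ<p m m<N)))))
          (*-zeroʳ (isZero (z-of (m - P * R)))))
        where
        c′ : Coordinates p q r (m - P * R)
        c′ = coordinates (t - P) (ℕ.pred q) z (pred-< q {{q≢0}}) z<r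
          (trans (cong (_- P * R) (trans eq (sym (lattice-transpose P Q R t (+ 0) (+ z)))))
            (trans (lattice-z-borrow P R Q t (+ z))
              (trans (lattice-transpose P Q R (t - P) (Q - 1ℤ) (+ z))
                (cong (λ x → lattice P Q R (t - P) x (+ z)) (pred-eq q {{q≢0}})))))

      zero-coordinates : Coordinates p q r 0ℤ
      zero-coordinates = coordinates 0ℤ 0 0 (ℕ.≤-<-trans ℕ.z≤n s<q) (ℕ.≤-<-trans ℕ.z≤n u<r)
        (sym (trans (lattice-axis P Q R 0ℤ) (*-zeroʳ (Q * R))))

      δ≢0 : ∀ {m} → m ≢ 0ℤ → δ m ≡ 0ℤ
      δ≢0 {+ zero}   m≢0 = contradiction refl m≢0
      δ≢0 {+ suc _}  _   = refl
      δ≢0 { -[1+ _ ]} _  = refl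

      nonneg-pred′ : ∀ x y w → x * (y * nonneg (w - 1ℤ)) - x * (y * nonneg w) ≡ - (x * (y * δ w))
      nonneg-pred′ x y w = trans
        (solve 4 (λ x y a b → x :* (y :* a) :- x :* (y :* b) := x :* (y :* (a :- b))) refl
          x y (nonneg (w - 1ℤ)) (nonneg w))
        (trans (cong (λ d → x * (y * d)) (nonneg-pred w))
          (solve 3 (λ x y d → x :* (y :* :- d) := :- (x :* (y :* d))) refl x y (δ w)))

      -- By uniqueness, m = 0 exactly when all three of its coordinates vanish.
      δ-coordinates : ∀ {m} (c : Coordinates p q r m) → let open Coordinates c in
        isZero y * (isZero z * δ t) ≡ δ m
      δ-coordinates {m} c@(coordinates t (suc y) z _ _ _) = sym (δ≢0 {m} λ where
        refl → contradiction (y-unique c zero-coordinates) (λ ()))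
      δ-coordinates {m} c@(coordinates t zero (suc z) _ _ _) = sym (δ≢0 {m} λ where
        refl → contradiction (z-unique c zero-coordinates) (λ ()))
      δ-coordinates {m} c@(coordinates (+ zero) zero zero _ _ eq)
        rewrite trans eq (trans (lattice-axis P Q R 0ℤ) (*-zeroʳ (Q * R))) = refl
      δ-coordinates {m} c@(coordinates (+ suc t) zero zero _ _ _) = sym (δ≢0 {m} λ where
        refl → contradiction (t-unique c zero-coordinates) (λ ()))
      δ-coordinates {m} c@(coordinates -[1+ t ] zero zero _ _ _) = sym (δ≢0 {m} λ where
        refl → contradiction (t-unique c zero-coordinates) (λ ()))

      Δχyz : ∀ m → Δ (Q * R) χyz m ≡ - δ m
      Δχyz m = trans
        (cong (_- χyz m) (cong₂ (λ x w → isZero x * w) (y≡ c′)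
          (cong₂ (λ x w → isZero x * nonneg w) (z≡ c′) (τ≡ c′))))
        (trans (nonneg-pred′ (isZero (y-of m)) (isZero (z-of m)) (τ m))
          (cong -_ (δ-coordinates (coordinates-of m))))
        where
        open Coordinates (coordinates-of m)
        c′ : Coordinates p q r (m - Q * R)
        c′ = coordinates (t - 1ℤ) y z y<q z<r
          (trans (cong (_- Q * R) eq) (lattice-t-1 P Q R t (+ y) (+ z)))

    -- Each of the three factors has the shape x^d - 1 instead of 1 - x^d, so the product with the
    -- series of `χ` is -1 rather than 1.
    Δ³χ : ∀ m → m < P * Q * R → Δ (Q * R) (Δ (P * R) (Δ (P * Q) χ)) m ≡ - δ m
    Δ³χ m m<N = trans (cong₂ _-_ (twice (m - Q * R) (below q r m<N)) (twice m m<N)) (Δχyz m)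
      where
      below : ∀ i j {m} → m < P * Q * R → m - + i * + j < P * Q * R
      below i j {m} m<N = ≤-<-trans
        (subst (λ x → m - x ≤ m) (pos-* i j) (i≤j⇒i-k≤j (+ (i ℕ.* j)) ≤-refl)) m<N
      once : ∀ m → m < P * Q * R → Δ (P * Q) χ m ≡ - χz m
      once m m<N = Δχ-at m<N (coordinates-of m)
      twice : ∀ m → m < P * Q * R → Δ (P * R) (Δ (P * Q) χ) m ≡ χyz m
      twice m m<N = begin
        Δ (P * Q) χ (m - P * R) - Δ (P * Q) χ m
          ≡⟨ cong₂ _-_ (once (m - P * R) (below p r m<N)) (once m m<N) ⟩
        - χz (m - P * R) - - χz m
          ≡⟨ solve 2 (λ x y → :- x :- :- y := :- (x :- y)) refl (χz (m - P * R)) (χz m) ⟩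
        - Δ (P * R) χz m
          ≡⟨ cong -_ (Δχz-at m<N (coordinates-of m)) ⟩
        - - χyz m
          ≡⟨ neg-involutive (χyz m) ⟩
        χyz m ∎
        where open ≡-Reasoning

-- Laurent series over the field, and the factorization of x^n - 1.

module LaurentSequences where
  open import Algebra.Apartness.Bundles using (HeytingField; HeytingCommutativeRing)
  open import Algebra.Bundles using (CommutativeRing)
  import Algebra.Properties.CommutativeSemiring.Exp as Exp
  import Algebra.Properties.Ring as RingProperties
  import Algebra.Solver.Ring.NaturalCoefficients.Default as NaturalCoefficients
  open import Data.Integer.Base as ℤ using (ℤ; +_; -[1+_]; 1ℤ)
  import Data.Integer.Properties as ℤ
  open import Data.Integer.Solver using (module +-*-Solver)
  open import Data.List.Base using (List; []; _∷_; _++_; map; foldr; length; upTo; applyUpTo)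
  open import Data.List.Properties using (foldr-++; map-applyUpTo; applyUpTo-∷ʳ; length-applyUpTo; length-map; map-∘; map-cong; map-++)
  open import Data.List.Relation.Binary.Permutation.Propositional as ↭ using (_↭_)
  open import Data.Nat.Base as ℕ using (ℕ; zero; suc)
  import Data.Nat.Properties as ℕ
  open import Data.Product.Base using (_,_)
  import Relation.Binary.Reasoning.Setoid as SetoidReasoning
  open import Relation.Binary.Definitions using (tri<; tri≈; tri>)
  open import Relation.Binary.PropositionalEquality as ≡ using (_≡_; _≢_)
  open import Relation.Nullary.Negation using (¬_; contradiction)

  module Sequences {c ℓ₁ ℓ₂} (K : HeytingField c ℓ₁ ℓ₂) where
    open Cyclotomic K
    open HeytingCommutativeRing (HeytingField.heytingCommutativeRing K) using (commutativeRing; _#_; #⇒invertible)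
    open CommutativeRing commutativeRing
    open RingProperties ring
    open Exp commutativeSemiring
    open SetoidReasoning setoid
    open NaturalCoefficients commutativeSemiring using (solve; _:=_; _:+_; _:*_)

    -- Equality need not be decidable and `x` is not known to be invertible. By tightness it is
    -- enough to refute that `y` is apart from 0; were it apart, `y` could be cancelled instead.
    no-zero-divisors : ∀ {x y} → ¬ (x ≈ 0#) → x * y ≈ 0# → y ≈ 0#
    no-zero-divisors {x} {y} x≉0 xy≈0 = proj₁ (HeytingField.tight K y 0#) λ y#0 →
      let (y⁻¹ , _ , yy⁻¹≈1) = #⇒invertible y#0 in x≉0 (begin
        x                     ≈⟨ *-identityʳ x ⟨
        x * 1#                ≈⟨ *-congˡ yy⁻¹≈1 ⟨
        x * ((y - 0#) * y⁻¹)  ≈⟨ *-assoc x (y - 0#) y⁻¹ ⟨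
        x * (y - 0#) * y⁻¹    ≈⟨ *-congʳ (*-congˡ (trans (+-congˡ -0#≈0#) (+-identityʳ y))) ⟩
        x * y * y⁻¹           ≈⟨ *-congʳ xy≈0 ⟩
        0# * y⁻¹              ≈⟨ zeroˡ y⁻¹ ⟩
        0#                    ∎)
      where open Data.Product.Base using (proj₁)

    Sequence : Set c
    Sequence = ℤ → Carrier

    infix 4 _≋_
    _≋_ : Sequence → Sequence → Set ℓ₁
    f ≋ g = ∀ m → f m ≈ g m

    -- Multiplication of a Laurent series by x^d + a. Both the linear factors x - ζ^k and the
    -- binomials x^d - 1 are of this form, so one commutation lemma serves them all.
    T : ℤ → Carrier → Sequence → Sequence
    T d a f m = f (m ℤ.- d) + a * f m

    T-cong : ∀ d {a b f g} → a ≈ b → f ≋ g → T d a f ≋ T d b g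
    T-cong d a≈b f≋g m = +-cong (f≋g (m ℤ.- d)) (*-cong a≈b (f≋g m))

    T-comm : ∀ d e a b f → T d a (T e b f) ≋ T e b (T d a f)
    T-comm d e a b f m = begin
      f (m ℤ.- d ℤ.- e) + b * f (m ℤ.- d) + a * (f (m ℤ.- e) + b * f m)
        ≡⟨ ≡.cong (λ i → f i + b * f (m ℤ.- d) + a * (f (m ℤ.- e) + b * f m)) (exchange m d e) ⟩
      f (m ℤ.- e ℤ.- d) + b * f (m ℤ.- d) + a * (f (m ℤ.- e) + b * f m)
        ≈⟨ solve 6 (λ x y z w a b →
             x :+ b :* y :+ a :* (z :+ b :* w) := x :+ a :* z :+ b :* (y :+ a :* w)) refl
             (f (m ℤ.- e ℤ.- d)) (f (m ℤ.- d)) (f (m ℤ.- e)) (f m) a b ⟩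
      f (m ℤ.- e ℤ.- d) + a * f (m ℤ.- e) + b * (f (m ℤ.- d) + a * f m) ∎
      where
      exchange : ∀ m d e → m ℤ.- d ℤ.- e ≡ m ℤ.- e ℤ.- d
      exchange = S.solve 3 (λ m d e → m S.:- d S.:- e S.:= m S.:- e S.:- d) ≡.refl
        where module S = +-*-Solver

    ⟦_⟧ : Poly → Sequence
    ⟦ f ⟧ (+ n)    = coeff f n
    ⟦ f ⟧ -[1+ _ ] = 0#

    δ : Sequence
    δ = ⟦ 1# ∷ [] ⟧

    coeff-+ᴾ : ∀ f g n → coeff (f +ᴾ g) n ≈ coeff f n + coeff g n
    coeff-+ᴾ []      g       n       = sym (+-identityˡ (coeff g n))
    coeff-+ᴾ (a ∷ f) []      n       = sym (+-identityʳ (coeff (a ∷ f) n))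
    coeff-+ᴾ (a ∷ f) (b ∷ g) zero    = refl
    coeff-+ᴾ (a ∷ f) (b ∷ g) (suc n) = coeff-+ᴾ f g n

    coeff-map : ∀ a f n → coeff (map (a *_) f) n ≈ a * coeff f n
    coeff-map a []      n       = sym (zeroʳ a)
    coeff-map a (b ∷ f) zero    = refl
    coeff-map a (b ∷ f) (suc n) = coeff-map a f n

    coeff-0 : ∀ n → coeff (0# ∷ []) n ≈ 0#
    coeff-0 zero    = refl
    coeff-0 (suc n) = refl

    ⟦X-⟧ : ∀ a g → ⟦ (X- a) *ᴾ g ⟧ ≋ T 1ℤ (- a) ⟦ g ⟧
    ⟦X-⟧ a g -[1+ n ] = sym (trans (+-congˡ (zeroʳ (- a))) (+-identityˡ 0#))
    ⟦X-⟧ a g (+ zero) = begin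
      coeff (map (- a *_) g +ᴾ (0# ∷ (map (1# *_) g +ᴾ (0# ∷ [])))) 0
        ≈⟨ coeff-+ᴾ (map (- a *_) g) (0# ∷ (map (1# *_) g +ᴾ (0# ∷ []))) 0 ⟩
      coeff (map (- a *_) g) 0 + 0#
        ≈⟨ +-comm (coeff (map (- a *_) g) 0) 0# ⟩
      0# + coeff (map (- a *_) g) 0
        ≈⟨ +-congˡ (coeff-map (- a) g 0) ⟩
      0# + - a * coeff g 0 ∎
    ⟦X-⟧ a g (+ suc n) = begin
      coeff (map (- a *_) g +ᴾ (0# ∷ (map (1# *_) g +ᴾ (0# ∷ [])))) (suc n)
        ≈⟨ coeff-+ᴾ (map (- a *_) g) (0# ∷ (map (1# *_) g +ᴾ (0# ∷ []))) (suc n) ⟩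
      coeff (map (- a *_) g) (suc n) + coeff (map (1# *_) g +ᴾ (0# ∷ [])) n
        ≈⟨ +-cong (coeff-map (- a) g (suc n))
             (trans (coeff-+ᴾ (map (1# *_) g) (0# ∷ []) n)
               (trans (+-cong (trans (coeff-map 1# g n) (*-identityˡ (coeff g n))) (coeff-0 n))
                 (+-identityʳ (coeff g n)))) ⟩
      - a * coeff g (suc n) + coeff g n
        ≈⟨ +-comm (- a * coeff g (suc n)) (coeff g n) ⟩
      coeff g n + - a * coeff g (suc n) ∎

    -- Restricts to power series. On arbitrary sequences the operator for x^d - 1 annihilates every
    -- d-periodic sequence, so it could not be cancelled.
    Causal : Sequence → Set ℓ₁
    Causal f = ∀ n → f -[1+ n ] ≈ 0#

    T-causal : ∀ d a {f} → Causal f → Causal (T (+ d) a f)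
    T-causal zero    a {f} f-causal n = trans (+-cong (f-causal n) (*-congˡ (f-causal n)))
      (trans (+-identityˡ (a * 0#)) (zeroʳ a))
    T-causal (suc d) a {f} f-causal n = trans (+-cong (f-causal (suc (n ℕ.+ d))) (*-congˡ (f-causal n)))
      (trans (+-identityˡ (a * 0#)) (zeroʳ a))

    -- The constant term of x^(1 + d) - 1 is -1, so each coefficient is determined by the image and
    -- the coefficient 1 + d places lower. Only lower indices occur, which makes the truncation at N
    -- harmless.
    T-injective : ∀ d N {f g} → Causal f → Causal g →
      (∀ m → m ℤ.< + N → T (+ suc d) (- 1#) f m ≈ T (+ suc d) (- 1#) g m) →
      ∀ m → m ℤ.< + N → f m ≈ g m
    T-injective d N {f} {g} f-causal g-causal eq = everywhere
      where
      step : ∀ {x y x′ y′} → x ≈ y → x + - 1# * x′ ≈ y + - 1# * y′ → x′ ≈ y′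
      step {x} {y} {x′} {y′} x≈y h = -‿injective (begin
        - x′       ≈⟨ -1*x≈-x x′ ⟨
        - 1# * x′  ≈⟨ +-cancelˡ x _ _ (trans h (+-congʳ (sym x≈y))) ⟩
        - 1# * y′  ≈⟨ -1*x≈-x y′ ⟩
        - y′       ∎)
      -- `k` is fuel for strong induction: the previous index is smaller than `n` but not
      -- structurally so.
      below : ∀ k n → n ℕ.< k → n ℕ.< N → f (+ n) ≈ g (+ n)
      below (suc k) n n<1+k n<N = step before (eq (+ n) (ℤ.+<+ n<N))
        where
        before : f (+ n ℤ.- + suc d) ≈ g (+ n ℤ.- + suc d)
        before with + n ℤ.- + suc d in eq
        ... | -[1+ i ] = trans (f-causal i) (sym (g-causal i))
        ... | + i      = below k i (ℕ.<-≤-trans i<n (ℕ.s≤s⁻¹ n<1+k)) (ℕ.<-trans i<n n<N)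
          where
          i<n : i ℕ.< n
          i<n = ℤ.drop‿+<+ (≡.subst (ℤ._< + n) eq (ℤ.m⊖1+n<m n (suc d)))
      everywhere : ∀ m → m ℤ.< + N → f m ≈ g m
      everywhere -[1+ n ] _   = trans (f-causal n) (sym (g-causal n))
      everywhere (+ n)    n<N = below (suc n) n (ℕ.n<1+n n) (ℤ.drop‿+<+ n<N)

    T-≋ : ∀ d a {f g} → f ≋ g → T d a f ≋ T d a g
    T-≋ d a = T-cong d refl

    module Roots (ζ : Carrier) where

      factor : ℕ → Sequence → Sequence
      factor k = T 1ℤ (- (ζ ^ k))

      ∏ : List ℕ → Sequence → Sequence
      ∏ ks f = foldr factor f ks

      ∏-cong : ∀ ks {f g} → f ≋ g → ∏ ks f ≋ ∏ ks g
      ∏-cong []       f≋g = f≋g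
      ∏-cong (k ∷ ks) f≋g = T-≋ 1ℤ (- (ζ ^ k)) (∏-cong ks f≋g)

      ∏-T : ∀ ks d a f → ∏ ks (T d a f) ≋ T d a (∏ ks f)
      ∏-T []       d a f m = refl
      ∏-T (k ∷ ks) d a f m = trans (T-≋ 1ℤ (- (ζ ^ k)) (∏-T ks d a f) m)
        (T-comm 1ℤ d (- (ζ ^ k)) a (∏ ks f) m)

      ∏-↭ : ∀ {ks ls} → ks ↭ ls → ∀ f → ∏ ks f ≋ ∏ ls f
      ∏-↭ ↭.refl                           f m = refl
      ∏-↭ (↭.prep k ks↭ls)                 f m = T-≋ 1ℤ (- (ζ ^ k)) (∏-↭ ks↭ls f) m
      ∏-↭ {k ∷ l ∷ ks} (↭.swap k l ks↭ls) f m = trans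
        (T-comm 1ℤ 1ℤ (- (ζ ^ k)) (- (ζ ^ l)) (∏ ks f) m)
        (T-≋ 1ℤ (- (ζ ^ l)) (T-≋ 1ℤ (- (ζ ^ k)) (∏-↭ ks↭ls f)) m)
      ∏-↭ (↭.trans p q)                    f m = trans (∏-↭ p f m) (∏-↭ q f m)

      ⟦productᴾ⟧ : ∀ ks → ⟦ productᴾ (map (λ k → X- (ζ ^ k)) ks) ⟧ ≋ ∏ ks δ
      ⟦productᴾ⟧ []       m = refl
      ⟦productᴾ⟧ (k ∷ ks) m = trans (⟦X-⟧ (ζ ^ k) (productᴾ (map (λ k → X- (ζ ^ k)) ks)) m)
        (T-≋ 1ℤ (- (ζ ^ k)) (⟦productᴾ⟧ ks) m)

      ∏-causal : ∀ ks → Causal (∏ ks δ)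
      ∏-causal []       n = refl
      ∏-causal (k ∷ ks) = T-causal 1 (- (ζ ^ k)) {∏ ks δ} (∏-causal ks)

      ∏-degree : ∀ ks {n} → length ks ℕ.< n → ∏ ks δ (+ n) ≈ 0#
      ∏-degree []       {suc n} _         = refl
      ∏-degree (k ∷ ks) {suc n} (ℕ.s≤s h) = trans
        (+-cong (∏-degree ks h) (*-congˡ (∏-degree ks (ℕ.m<n⇒m<1+n h))))
        (trans (+-identityˡ _) (zeroʳ _))

      ∏-monic : ∀ ks → ∏ ks δ (+ length ks) ≈ 1#
      ∏-monic []       = refl
      ∏-monic (k ∷ ks) = trans
        (+-cong (∏-monic ks) (trans (*-congˡ (∏-degree ks (ℕ.n<1+n (length ks)))) (zeroʳ _)))
        (+-identityʳ 1#)

      -- Substituting ζ^d x for x multiplies x - ζ^(d+k) into ζ^d (x - ζ^k).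
      ∏-scale : ∀ d ks m →
        ζ ^ (d ℕ.* m) * ∏ (map (d ℕ.+_) ks) δ (+ m) ≈ ζ ^ (d ℕ.* length ks) * ∏ ks δ (+ m)
      ∏-scale d []       zero    = refl
      ∏-scale d []       (suc m) = trans (zeroʳ _) (sym (zeroʳ _))
      ∏-scale d (k ∷ ks) m = begin
        ζ ^ (d ℕ.* m) * (F′ (+ m ℤ.- 1ℤ) + - (ζ ^ (d ℕ.+ k)) * F′ (+ m))
          ≈⟨ *-congˡ (+-congˡ (*-congʳ (trans (-‿cong (^-homo-* ζ d k)) (-‿distribʳ-* (ζ ^ d) (ζ ^ k))))) ⟩
        ζ ^ (d ℕ.* m) * (F′ (+ m ℤ.- 1ℤ) + ζ ^ d * - (ζ ^ k) * F′ (+ m))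
          ≈⟨ solve 5 (λ x y a b z → x :* (y :+ a :* b :* z) := x :* y :+ a :* b :* (x :* z)) refl
               (ζ ^ (d ℕ.* m)) (F′ (+ m ℤ.- 1ℤ)) (ζ ^ d) (- (ζ ^ k)) (F′ (+ m)) ⟩
        ζ ^ (d ℕ.* m) * F′ (+ m ℤ.- 1ℤ) + ζ ^ d * - (ζ ^ k) * (ζ ^ (d ℕ.* m) * F′ (+ m))
          ≈⟨ +-cong (previous m) (*-congˡ (∏-scale d ks m)) ⟩
        ζ ^ d * (ζ ^ (d ℕ.* length ks) * F (+ m ℤ.- 1ℤ))
          + ζ ^ d * - (ζ ^ k) * (ζ ^ (d ℕ.* length ks) * F (+ m))
          ≈⟨ solve 5 (λ a w x b y → a :* (w :* x) :+ a :* b :* (w :* y) := a :* w :* (x :+ b :* y)) refl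
               (ζ ^ d) (ζ ^ (d ℕ.* length ks)) (F (+ m ℤ.- 1ℤ)) (- (ζ ^ k)) (F (+ m)) ⟩
        ζ ^ d * ζ ^ (d ℕ.* length ks) * (F (+ m ℤ.- 1ℤ) + - (ζ ^ k) * F (+ m))
          ≈⟨ *-congʳ (power-suc (length ks)) ⟨
        ζ ^ (d ℕ.* suc (length ks)) * (F (+ m ℤ.- 1ℤ) + - (ζ ^ k) * F (+ m)) ∎
        where
        F F′ : Sequence
        F  = ∏ ks δ
        F′ = ∏ (map (d ℕ.+_) ks) δ
        power-suc : ∀ i → ζ ^ (d ℕ.* suc i) ≈ ζ ^ d * ζ ^ (d ℕ.* i)
        power-suc i = trans (^-congʳ ζ (ℕ.*-suc d i)) (^-homo-* ζ d (d ℕ.* i))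
        previous : ∀ m → ζ ^ (d ℕ.* m) * F′ (+ m ℤ.- 1ℤ) ≈
          ζ ^ d * (ζ ^ (d ℕ.* length ks) * F (+ m ℤ.- 1ℤ))
        previous zero = trans
          (trans (*-congˡ (∏-causal (map (d ℕ.+_) ks) 0)) (zeroʳ _))
          (sym (trans (*-congˡ (trans (*-congˡ (∏-causal ks 0)) (zeroʳ _))) (zeroʳ _)))
        previous (suc m) = trans (*-congʳ (power-suc m))
          (trans (*-assoc _ _ _) (*-congˡ (∏-scale d ks m)))

      multiples : ℕ → ℕ → List ℕ
      multiples d n = map (d ℕ.*_) (upTo n)

      module _ (d n : ℕ) (ζ^dn≈1 : ζ ^ (d ℕ.* suc n) ≈ 1#)
        (order : ∀ k → 0 ℕ.< k → k ℕ.< suc n → ¬ (ζ ^ (d ℕ.* k) ≈ 1#)) where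

        private
          rest : List ℕ
          rest = map (d ℕ.*_) (applyUpTo suc n)

          G H : Sequence
          G = ∏ (multiples d (suc n)) δ
          H = ∏ rest δ

          length-rest : length rest ≡ n
          length-rest = ≡.trans (length-map (d ℕ.*_) (applyUpTo suc n)) (length-applyUpTo suc n)

          length-multiples : length (multiples d (suc n)) ≡ suc n
          length-multiples = ≡.cong suc length-rest

          shifted : map (d ℕ.+_) (multiples d (suc n)) ≡ rest ++ d ℕ.* suc n ∷ []
          shifted = E.begin
            map (d ℕ.+_) (map (d ℕ.*_) (upTo (suc n)))
              E.≡⟨ map-∘ (upTo (suc n)) ⟨
            map (λ i → d ℕ.+ d ℕ.* i) (upTo (suc n))
              E.≡⟨ map-cong (λ i → ≡.sym (ℕ.*-suc d i)) (upTo (suc n)) ⟩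
            map (λ i → d ℕ.* suc i) (upTo (suc n))
              E.≡⟨ map-∘ (upTo (suc n)) ⟩
            map (d ℕ.*_) (map suc (upTo (suc n)))
              E.≡⟨ ≡.cong (map (d ℕ.*_))
                     (≡.trans (map-applyUpTo (λ i → i) suc (suc n)) (≡.sym (applyUpTo-∷ʳ suc n))) ⟩
            map (d ℕ.*_) (applyUpTo suc n ++ suc n ∷ [])
              E.≡⟨ map-++ (d ℕ.*_) (applyUpTo suc n) (suc n ∷ []) ⟩
            rest ++ d ℕ.* suc n ∷ [] E.∎
            where module E = ≡.≡-Reasoning

          -- Adding d to all exponents only replaces the first, d * 0, by d * (1 + n), and both
          -- belong to the root 1. Thus multiplying the roots by ζ^d permutes them.
          G-shifted : ∏ (map (d ℕ.+_) (multiples d (suc n))) δ ≋ G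
          G-shifted m = begin
            ∏ (map (d ℕ.+_) (multiples d (suc n))) δ m
              ≡⟨ ≡.cong (λ ks → ∏ ks δ m) shifted ⟩
            ∏ (rest ++ d ℕ.* suc n ∷ []) δ m
              ≡⟨ ≡.cong (λ f → f m) (foldr-++ factor δ rest (d ℕ.* suc n ∷ [])) ⟩
            ∏ rest (factor (d ℕ.* suc n) δ) m
              ≈⟨ ∏-T rest 1ℤ (- (ζ ^ (d ℕ.* suc n))) δ m ⟩
            factor (d ℕ.* suc n) H m
              ≈⟨ T-cong 1ℤ {f = H} (-‿cong (trans ζ^dn≈1 (^-congʳ ζ (≡.sym (ℕ.*-zeroʳ d)))))
                   (λ _ → refl) m ⟩
            factor (d ℕ.* 0) H m ∎

          -- By `∏-scale`, invariance under this rotation says (ζ^(dk) - 1) G_k = 0, and the order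
          -- hypothesis makes the first factor nonzero.
          vanishes : ∀ k → 0 ℕ.< k → k ℕ.< suc n → G (+ k) ≈ 0#
          vanishes k 0<k k<n = no-zero-divisors
            (λ z → order k 0<k k<n (x∙y⁻¹≈ε⇒x≈y _ _ z)) (begin
            (ζ ^ (d ℕ.* k) + - 1#) * G (+ k)
              ≈⟨ distribʳ (G (+ k)) (ζ ^ (d ℕ.* k)) (- 1#) ⟩
            ζ ^ (d ℕ.* k) * G (+ k) + - 1# * G (+ k)
              ≈⟨ +-cong scaled (-1*x≈-x (G (+ k))) ⟩
            G (+ k) + - G (+ k)
              ≈⟨ -‿inverseʳ (G (+ k)) ⟩
            0# ∎)
            where
            scaled : ζ ^ (d ℕ.* k) * G (+ k) ≈ G (+ k)
            scaled = begin
              ζ ^ (d ℕ.* k) * G (+ k)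
                ≈⟨ *-congˡ (G-shifted (+ k)) ⟨
              ζ ^ (d ℕ.* k) * ∏ (map (d ℕ.+_) (multiples d (suc n))) δ (+ k)
                ≈⟨ ∏-scale d (multiples d (suc n)) k ⟩
              ζ ^ (d ℕ.* length (multiples d (suc n))) * G (+ k)
                ≈⟨ *-congʳ (trans (^-congʳ ζ (≡.cong (d ℕ.*_) length-multiples)) ζ^dn≈1) ⟩
              1# * G (+ k)
                ≈⟨ *-identityˡ (G (+ k)) ⟩
              G (+ k) ∎

          G-step : ∀ m → G m ≈ H (m ℤ.- 1ℤ) + - 1# * H m
          G-step m = +-congˡ (*-congʳ (-‿cong (^-congʳ ζ (ℕ.*-zeroʳ d))))

          H-constant : ∀ k → k ℕ.≤ n → H (+ k) ≈ H (+ 0)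
          H-constant zero    _   = refl
          H-constant (suc k) k<n = trans (sym equal) (H-constant k (ℕ.<⇒≤ k<n))
            where
            equal : H (+ k) ≈ H (+ suc k)
            equal = x∙y⁻¹≈ε⇒x≈y _ _ (trans (+-congˡ (sym (-1*x≈-x _)))
              (trans (sym (G-step (+ suc k))) (vanishes (suc k) (ℕ.s≤s ℕ.z≤n) (ℕ.s≤s k<n))))

          -- The constant term is found without multiplying the roots: G = (x - 1) H, and the
          -- vanishing middle coefficients of G make all coefficients of H up to n equal to its
          -- leading one, which is 1.
          G-zero : G (+ 0) ≈ - 1#
          G-zero = begin
            G (+ 0)
              ≈⟨ G-step (+ 0) ⟩
            H -[1+ 0 ] + - 1# * H (+ 0)
              ≈⟨ +-cong (∏-causal rest 0) (*-congˡ (trans (sym (H-constant n ℕ.≤-refl)) monic)) ⟩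
            0# + - 1# * 1#
              ≈⟨ trans (+-identityˡ _) (*-identityʳ _) ⟩
            - 1# ∎
            where
            monic : H (+ n) ≈ 1#
            monic = ≡.subst (λ k → H (+ k) ≈ 1#) length-rest (∏-monic rest)

          δ-shift : ∀ {i j} → i ≡ j → δ i ≈ δ j
          δ-shift ≡.refl = refl

          δ-distinct : ∀ i j → i ≢ j → δ (+ i ℤ.- + j) ≈ 0#
          δ-distinct i j i≢j with + i ℤ.- + j in eq
          ... | -[1+ _ ] = refl
          ... | + suc _  = refl
          ... | + zero   = contradiction (ℤ.+-injective (ℤ.i-j≡0⇒i≡j (+ i) (+ j) eq)) i≢j

        ∏-multiples : ∏ (multiples d (suc n)) δ ≋ T (+ suc n) (- 1#) δ
        ∏-multiples -[1+ m ] = trans (∏-causal (multiples d (suc n)) m)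
          (sym (trans (+-identityˡ _) (zeroʳ _)))
        ∏-multiples (+ zero) = trans G-zero
          (sym (trans (+-identityˡ _) (*-identityʳ _)))
        ∏-multiples (+ suc m) with ℕ.<-cmp (suc m) (suc n)
        ... | tri< m<n _ _ = trans (vanishes (suc m) (ℕ.s≤s ℕ.z≤n) m<n)
          (sym (trans (+-cong (δ-distinct (suc m) (suc n) (ℕ.<⇒≢ m<n)) (zeroʳ _)) (+-identityˡ 0#)))
        ... | tri≈ _ ≡.refl _ = trans
          (≡.subst (λ k → G (+ k) ≈ 1#) length-multiples (∏-monic (multiples d (suc n))))
          (sym (trans (+-cong (δ-shift (ℤ.+-inverseʳ (+ suc n))) (zeroʳ _)) (+-identityʳ 1#)))
        ... | tri> _ _ n<m = trans
          (∏-degree (multiples d (suc n)) (≡.subst (ℕ._< suc m) (≡.sym length-multiples) n<m))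
          (sym (trans (+-cong (δ-distinct (suc m) (suc n) (ℕ.>⇒≢ n<m)) (zeroʳ _)) (+-identityˡ 0#)))

-- Inclusion-exclusion for the exponents of the roots.

module Permutations where
  open import Data.Bool.Base using (Bool; true; false; not; _∧_; if_then_else_)
  open import Data.List.Base using (List; []; _∷_; _++_; map; filter; filterᵇ; concatMap; replicate; upTo)
  open import Data.List.Membership.Propositional using (_∈_)
  open import Data.List.Membership.Propositional.Properties using (∈-filter⁺; ∈-filter⁻; ∈-upTo⁺; ∈-upTo⁻; ∈-map⁺; ∈-map⁻)
  open import Data.List.Membership.Propositional.Properties.WithK using (unique∧set⇒bag)
  open import Data.List.Relation.Binary.BagAndSetEquality using (∼bag⇒↭)
  open import Data.List.Relation.Binary.Permutation.Propositional using (_↭_; ↭-refl; ↭-reflexive; ↭-trans; ↭-sym; prep; module PermutationReasoning)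
  open import Data.List.Relation.Binary.Permutation.Propositional.Properties using (++⁺; ++⁺ˡ; shifts)
  import Data.List.Relation.Unary.Unique.Propositional.Properties as Unique
  open import Data.Nat.Base
  open import Data.Nat.Coprimality as Coprimality using (Coprime; coprime-divisor; coprime⇒gcd≡1; gcd≡1⇒coprime; prime⇒coprime)
  open import Data.Nat.Divisibility
  open import Data.Nat.GCD using (gcd; gcd[m,n]∣m; gcd[m,n]∣n; gcd-greatest)
  open import Data.Nat.Primality using (Prime; prime⇒nonZero; prime⇒nonTrivial; prime⇒irreducible)
  open import Data.Nat.Properties
  open import Data.Product.Base using (_×_; _,_)
  open import Data.Sum.Base using (inj₁; inj₂)
  open import Function.Base using (_∘_)
  open import Function.Bundles using (_⇔_; mk⇔)
  open import Relation.Binary.Definitions using (tri<; tri≈; tri>)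
  open import Relation.Binary.PropositionalEquality
  open import Relation.Nullary.Decidable using (Dec; does; _×-dec_; does-⇔; dec-true; ¬?)
  open import Relation.Nullary.Negation using (¬_; contradiction)

  count : List (ℕ → Bool) → ℕ → ℕ
  count []       x = 0
  count (f ∷ fs) x = (if f x then suc else λ n → n) (count fs x)

  -- Inclusion–exclusion is stated for multisets of exponents, so that no factor has to be cancelled.
  filters : List (ℕ → Bool) → List ℕ → List ℕ
  filters fs xs = concatMap (λ f → filterᵇ f xs) fs

  filters-∷ : ∀ fs x xs → filters fs (x ∷ xs) ↭ replicate (count fs x) x ++ filters fs xs
  filters-∷ []       x xs = ↭-refl
  filters-∷ (f ∷ fs) x xs with f x
  ... | false = ↭-trans (++⁺ˡ (filterᵇ f xs) (filters-∷ fs x xs))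
      (shifts (filterᵇ f xs) (replicate (count fs x) x))
  ... | true  = prep x (↭-trans (++⁺ˡ (filterᵇ f xs) (filters-∷ fs x xs))
      (shifts (filterᵇ f xs) (replicate (count fs x) x)))

  -- The number of filters accepting x is its multiplicity in the concatenation per occurrence in
  -- the list, so an identity of multisets reduces to a pointwise count.
  filters-↭ : ∀ fs gs → (∀ x → count fs x ≡ count gs x) → ∀ xs → filters fs xs ↭ filters gs xs
  filters-↭ fs gs eq []       = ↭-trans (filters-[] fs) (↭-sym (filters-[] gs))
    where
    filters-[] : ∀ fs → filters fs [] ↭ []
    filters-[] []       = ↭-refl
    filters-[] (f ∷ fs) = filters-[] fs
  filters-↭ fs gs eq (x ∷ xs) = begin
    filters fs (x ∷ xs)                        ↭⟨ filters-∷ fs x xs ⟩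
    replicate (count fs x) x ++ filters fs xs  ↭⟨ ++⁺ˡ _ (filters-↭ fs gs eq xs) ⟩
    replicate (count fs x) x ++ filters gs xs  ≡⟨ cong (λ n → replicate n x ++ filters gs xs) (eq x) ⟩
    replicate (count gs x) x ++ filters gs xs  ↭⟨ filters-∷ gs x xs ⟨
    filters gs (x ∷ xs)                        ∎
    where open PermutationReasoning

  filter≡filterᵇ : ∀ {P : ℕ → Set} (P? : ∀ x → Dec (P x)) xs → filter P? xs ≡ filterᵇ (does ∘ P?) xs
  filter≡filterᵇ P? []       = refl
  filter≡filterᵇ P? (x ∷ xs) with does (P? x)
  ... | false = filter≡filterᵇ P? xs
  ... | true  = cong (x ∷_) (filter≡filterᵇ P? xs)

  -- Both lists are free of repetitions, so having the same members makes them permutations of each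
  -- other.
  multiples-↭ : ∀ d n → .{{_ : NonZero d}} →
    map (d *_) (upTo n) ↭ filter (d ∣?_) (upTo (d * n))
  multiples-↭ d n = ∼bag⇒↭ (unique∧set⇒bag
    (Unique.map⁺ (λ {i} {j} → *-cancelˡ-≡ i j d) (Unique.upTo⁺ n))
    (Unique.filter⁺ (d ∣?_) (Unique.upTo⁺ (d * n)))
    (mk⇔ to from))
    where
    to : ∀ {k} → k ∈ map (d *_) (upTo n) → k ∈ filter (d ∣?_) (upTo (d * n))
    to k∈ with i , i∈ , refl ← ∈-map⁻ (d *_) k∈ =
      ∈-filter⁺ (d ∣?_) (∈-upTo⁺ (*-monoʳ-< d (∈-upTo⁻ i∈))) (m∣m*n i)
    from : ∀ {k} → k ∈ filter (d ∣?_) (upTo (d * n)) → k ∈ map (d *_) (upTo n)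
    from {k} k∈ with k∈′ , divides i refl ← ∈-filter⁻ (d ∣?_) {xs = upTo (d * n)} k∈ =
      subst (_∈ map (d *_) (upTo n)) (*-comm d i)
        (∈-map⁺ (d *_) (∈-upTo⁺ (*-cancelˡ-< d i n (subst (_< d * n) (*-comm i d) (∈-upTo⁻ k∈′)))))

  coprime-* : ∀ {k m n} → Coprime k m → Coprime k n → Coprime k (m * n)
  coprime-* km kn (i∣k , i∣mn) =
    kn (i∣k , coprime-divisor (λ (j∣i , j∣m) → km (∣-trans j∣i i∣k , j∣m)) i∣mn)

  coprime⇒*∣ : ∀ {m n k} → Coprime m n → m ∣ k → n ∣ k → m * n ∣ k
  coprime⇒*∣ {m} {n} mn (divides i refl) n∣im =
    subst (m * n ∣_) (*-comm m i)
      (*-monoʳ-∣ m (coprime-divisor (Coprimality.sym mn) (subst (n ∣_) (*-comm i m) n∣im)))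

  ∤⇒coprime : ∀ {p k} → Prime p → ¬ (p ∣ k) → Coprime k p
  ∤⇒coprime {p} {k} pp p∤k = gcd≡1⇒coprime (is-one (prime⇒irreducible pp (gcd[m,n]∣n k p)))
    where
    is-one : _ → gcd k p ≡ 1
    is-one (inj₁ eq) = eq
    is-one (inj₂ eq) = contradiction (subst (_∣ k) eq (gcd[m,n]∣m k p)) p∤k

  distinct-primes-coprime : ∀ {p q} → Prime p → Prime q → p ≢ q → Coprime p q
  distinct-primes-coprime {p} {q} pp pq p≢q with <-cmp p q
  ... | tri< p<q _ _ = Coprimality.sym (prime⇒coprime pq {{prime⇒nonZero pp}} p<q)
  ... | tri≈ _ p≡q _ = contradiction p≡q p≢q
  ... | tri> _ _ q<p = prime⇒coprime pp {{prime⇒nonZero pq}} q<p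

  module InclusionExclusion {p q r} (pp : Prime p) (pq : Prime q) (pr : Prime r)
    (p≢q : p ≢ q) (p≢r : p ≢ r) (q≢r : q ≢ r) where

    N : ℕ
    N = p * q * r

    unit? : ∀ k → Dec (0 < k × gcd k N ≡ 1)
    unit? k = (0 <? k) ×-dec (gcd k N ≟ 1)

    private
      p⊥q : Coprime p q
      p⊥q = distinct-primes-coprime pp pq p≢q
      p⊥r : Coprime p r
      p⊥r = distinct-primes-coprime pp pr p≢r
      q⊥r : Coprime q r
      q⊥r = distinct-primes-coprime pq pr q≢r
      pq⊥r : Coprime (p * q) r
      pq⊥r = Coprimality.sym (coprime-* (Coprimality.sym p⊥r) (Coprimality.sym q⊥r))

      p∣N : p ∣ N
      p∣N = ∣-trans (m∣m*n q) (m∣m*n r)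
      q∣N : q ∣ N
      q∣N = ∣-trans (n∣m*n p) (m∣m*n r)
      r∣N : r ∣ N
      r∣N = n∣m*n (p * q)

      not-unit : ∀ {s k} → Prime s → s ∣ N → gcd k N ≡ 1 → ¬ (s ∣ k)
      not-unit ps s∣N eq s∣k = nonTrivial⇒≢1 {{prime⇒nonTrivial ps}}
        (∣1⇒≡1 (subst (_ ∣_) eq (gcd-greatest s∣k s∣N)))

      unit⇔ : ∀ k → (0 < k × gcd k N ≡ 1) ⇔ (¬ (p ∣ k) × ¬ (q ∣ k) × ¬ (r ∣ k))
      unit⇔ k = mk⇔
        (λ (_ , eq) → not-unit pp p∣N eq , not-unit pq q∣N eq , not-unit pr r∣N eq)
        (λ (p∤k , q∤k , r∤k) →
          n≢0⇒n>0 (λ k≡0 → p∤k (subst (p ∣_) (sym k≡0) (p ∣0))) ,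
          coprime⇒gcd≡1
            (coprime-* (coprime-* (∤⇒coprime pp p∤k) (∤⇒coprime pq q∤k)) (∤⇒coprime pr r∤k)))

      product⇔ : ∀ {m n} k → Coprime m n → (m * n ∣ k) ⇔ (m ∣ k × n ∣ k)
      product⇔ {m} {n} k mn = mk⇔
        (λ h → ∣-trans (m∣m*n n) h , ∣-trans (n∣m*n m) h)
        (λ (h , h′) → coprime⇒*∣ mn h h′)

      divides? : ℕ → ℕ → Bool
      divides? d k = does (d ∣? k)

    -- Multiples of d below N are the exponents of the roots of x^(N/d) - 1. So `left` encodes (x^qr
    -- - 1)(x^pr - 1)(x^pq - 1)(x - 1)Φ and `right` encodes (x^p - 1)(x^q - 1)(x^r - 1)(x^N - 1).
    left right : List (ℕ → Bool)
    left  = divides? p ∷ divides? q ∷ divides? r ∷ divides? N ∷ does ∘ unit? ∷ []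
    right = divides? (q * r) ∷ divides? (p * r) ∷ divides? (p * q) ∷ divides? 1 ∷ []

    -- By coprimality every filter is a Boolean combination of divisibility by p, q and r, which
    -- leaves a truth table with eight rows.
    counts : ∀ k → count left k ≡ count right k
    counts k
      rewrite does-⇔ (unit⇔ k) (unit? k) (¬? (p ∣? k) ×-dec (¬? (q ∣? k) ×-dec ¬? (r ∣? k)))
            | does-⇔ (product⇔ k pq⊥r) (N ∣? k) ((p * q ∣? k) ×-dec (r ∣? k))
            | does-⇔ (product⇔ k p⊥q) (p * q ∣? k) ((p ∣? k) ×-dec (q ∣? k))
            | does-⇔ (product⇔ k p⊥r) (p * r ∣? k) ((p ∣? k) ×-dec (r ∣? k))
            | does-⇔ (product⇔ k q⊥r) (q * r ∣? k) ((q ∣? k) ×-dec (r ∣? k))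
            | dec-true (1 ∣? k) (1∣ k) = venn (divides? p k) (divides? q k) (divides? r k)
      where
      venn : ∀ a b c →
        (if a then suc else λ n → n) ((if b then suc else λ n → n) ((if c then suc else λ n → n)
          ((if (a ∧ b) ∧ c then suc else λ n → n)
          ((if not a ∧ not b ∧ not c then suc else λ n → n) 0)))) ≡
        (if b ∧ c then suc else λ n → n) ((if a ∧ c then suc else λ n → n)
          ((if a ∧ b then suc else λ n → n) 1))
      venn false false false = refl
      venn false false true  = refl
      venn false true  false = refl
      venn false true  true  = refl
      venn true  false false = refl
      venn true  false true  = refl
      venn true  true  false = refl
      venn true  true  true  = refl

    inclusion–exclusion :
      map (p *_) (upTo (q * r)) ++ map (q *_) (upTo (p * r)) ++ map (r *_) (upTo (p * q)) ++
        map (N *_) (upTo 1) ++ filter unit? (upTo N) ++ [] ↭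
      map (q * r *_) (upTo p) ++ map (p * r *_) (upTo q) ++ map (p * q *_) (upTo r) ++
        map (1 *_) (upTo N) ++ []
    inclusion–exclusion = ↭-trans
      (++⁺ (multiples p (q * r) pp≢0 (sym (*-assoc p q r)))
        (++⁺ (multiples q (p * r) pq≢0 eq-q)
          (++⁺ (multiples r (p * q) pr≢0 (*-comm r (p * q)))
            (++⁺ (multiples N 1 N≢0 (*-identityʳ N))
              (++⁺ (↭-reflexive (filter≡filterᵇ unit? (upTo N))) ↭-refl)))))
      (↭-trans (filters-↭ left right counts (upTo N))
        (↭-sym (++⁺ (multiples (q * r) p qr≢0 (trans (*-comm (q * r) p) (sym (*-assoc p q r))))
          (++⁺ (multiples (p * r) q pr′≢0 (trans (*-comm (p * r) q) eq-q))
            (++⁺ (multiples (p * q) r pq′≢0 refl)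
              (++⁺ (multiples 1 N _ (*-identityˡ N)) ↭-refl))))))
      where
      pp≢0 = prime⇒nonZero pp
      pq≢0 = prime⇒nonZero pq
      pr≢0 = prime⇒nonZero pr
      pq′≢0 = m*n≢0 p q {{pp≢0}} {{pq≢0}}
      pr′≢0 = m*n≢0 p r {{pp≢0}} {{pr≢0}}
      qr≢0 = m*n≢0 q r {{pq≢0}} {{pr≢0}}
      N≢0 = m*n≢0 (p * q) r {{pq′≢0}} {{pr≢0}}
      eq-q : q * (p * r) ≡ N
      eq-q = trans (sym (*-assoc q p r)) (cong (_* r) (*-comm q p))
      multiples : ∀ d n → NonZero d → d * n ≡ N → map (d *_) (upTo n) ↭ filterᵇ (divides? d) (upTo N)
      multiples d n d≢0 eq = ↭-trans (multiples-↭ d n {{d≢0}})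
        (↭-reflexive (trans (cong (λ m → filter (d ∣?_) (upTo m)) eq) (filter≡filterᵇ (d ∣?_) (upTo N))))

-- Inverses modulo p, the identification of α and β*, and the maximum.

module Parameters where
  open Families using (distance; +∸)
  open LatticeCoordinates using (Inverses; residue-unique)
  open import Data.Integer.Base as ℤ using (ℤ; +_; 1ℤ)
  import Data.Integer.Properties as ℤ
  open import Data.Integer.Divisibility.Signed as ℤ∣ using (divides; ∣ᵤ⇒∣; ∣m∣n⇒∣m+n; ∣m∣n⇒∣m-n; ∣n⇒∣m*n; ∣m⇒∣m*n; ∣-refl)
  open import Data.Integer.Solver using (module +-*-Solver)
  open import Data.Nat.Base
  open import Data.Nat.Coprimality using (Coprime; coprime-Bézout)
  open import Data.Nat.Divisibility as ∣ using (_∣_)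
  open import Data.Nat.GCD using (module Bézout)
  open import Data.Nat.Properties
  open import Data.Product.Base using (_,_; ∃)
  open import Data.Sum.Base using (_⊎_; inj₁; inj₂)
  open import Relation.Binary.PropositionalEquality
  open +-*-Solver using (solve; _:+_; _:-_; :-_; _:*_; _:=_; con)

  ∣-∣-abs : ∀ m n → ∣ m - n ∣ ≡ ℤ.∣ + m ℤ.- + n ∣
  ∣-∣-abs m n = trans (go m n) (cong ℤ.∣_∣ (sym (ℤ.m-n≡m⊖n m n)))
    where
    go : ∀ m n → ∣ m - n ∣ ≡ ℤ.∣ m ℤ.⊖ n ∣
    go zero    zero    = refl
    go zero    (suc n) = refl
    go (suc m) zero    = refl
    go (suc m) (suc n) = trans (go m n) (cong ℤ.∣_∣ (sym (ℤ.[1+m]⊖[1+n]≡m⊖n m n)))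

  mod⇒∣ : ∀ {m n p} → m ≡ n mod p → + p ℤ∣.∣ + m ℤ.- + n
  mod⇒∣ {m} {n} {p} h = ∣ᵤ⇒∣ (subst (p ∣_) (∣-∣-abs m n) h)

  ≡1mod⇒ : ∀ {n p} → 0 < n → n ≡ 1 mod p → ∃ λ k → n ≡ 1 + p * k
  ≡1mod⇒ {suc n} {p} _ (∣.divides k eq) =
    k , cong suc (trans (sym (∣-∣-identityʳ n)) (trans eq (*-comm k p)))

  inverses : ∀ {p q r q′ r′} → 2 ≤ p → p < q → p < r → Coprime q r →
    0 < q′ → q′ < p → q * q′ ≡ 1 mod p → 0 < r′ → r′ < p → r * r′ ≡ 1 mod p →
    Inverses p q r q′ r′
  inverses {p} {q} {r} {q′} {r′} 2≤p p<q p<r q⊥r 0<q′ q′<p qq′≡1 0<r′ r′<p rr′≡1 =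
    let s , qq′ = ≡1mod⇒ (*-mono-< 0<q 0<q′) qq′≡1
        u , rr′ = ≡1mod⇒ (*-mono-< 0<r 0<r′) rr′≡1
        X , Y , bezout = integer-bezout (coprime-Bézout q⊥r)
    in record
      { s = s ; u = u ; X = X ; Y = Y ; qq′ = qq′ ; rr′ = rr′ ; bezout = bezout
      ; q≢0 = >-nonZero 0<q ; r≢0 = >-nonZero 0<r
      ; 2≤p = 2≤p ; p<q = p<q ; p<r = p<r
      ; s<q = quotient-< qq′ q′<p ; u<r = quotient-< rr′ r′<p
      }
    where
    0<q : 0 < q
    0<q = ≤-<-trans z≤n p<q
    0<r : 0 < r
    0<r = ≤-<-trans z≤n p<r

    quotient-< : ∀ {n n′ k} → n * n′ ≡ 1 + p * k → n′ < p → k < n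
    quotient-< {n} {n′} {k} eq n′<p = *-cancelˡ-< p k n (begin-strict
      p * k      <⟨ n<1+n (p * k) ⟩
      1 + p * k  ≡⟨ eq ⟨
      n * n′     ≤⟨ *-monoʳ-≤ n (<⇒≤ n′<p) ⟩
      n * p      ≡⟨ *-comm n p ⟩
      p * n      ∎)
      where open ≤-Reasoning

    lift : ∀ x y m n → 1 + y * n ≡ x * m → 1ℤ ℤ.+ + n ℤ.* + y ≡ + m ℤ.* + x
    lift x y m n eq = trans
      (cong (λ x → 1ℤ ℤ.+ x) (trans (sym (ℤ.pos-* n y)) (cong +_ (*-comm n y))))
      (trans (cong +_ eq) (trans (cong +_ (*-comm x m)) (ℤ.pos-* m x)))

    integer-bezout : Bézout.Identity 1 q r → ∃ λ X → ∃ λ Y → + q ℤ.* X ℤ.+ + r ℤ.* Y ≡ 1ℤ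
    integer-bezout (Bézout.+- x y eq) = + x , ℤ.- + y ,
      trans (cong (ℤ._+ + r ℤ.* ℤ.- + y) (sym (lift x y q r eq)))
        (solve 2 (λ r y → con 1ℤ :+ r :* y :+ r :* :- y := con 1ℤ) refl (+ r) (+ y))
    integer-bezout (Bézout.-+ x y eq) = ℤ.- + x , + y ,
      trans (cong (λ w → + q ℤ.* ℤ.- + x ℤ.+ w) (sym (lift y x r q eq)))
        (solve 2 (λ q x → q :* :- x :+ (con 1ℤ :+ q :* x) := con 1ℤ) refl (+ q) (+ x))

  distance-∸ : ∀ {p a} → a ≤ p → distance p (p ∸ a) ≡ distance p a
  distance-∸ {p} {a} a≤p = trans (⊓-comm (p ∸ a) (p ∸ (p ∸ a))) (cong (_⊓ (p ∸ a)) (m∸[m∸n]≡n a≤p))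

  module _ {p q r q′ r′ : ℕ} (q′<p : q′ < p) (qq′≡1 : q * q′ ≡ 1 mod p)
    (0<r′ : 0 < r′) (r′<p : r′ < p) (rr′≡1 : r * r′ ≡ 1 mod p) where

    private
      pos-product : ∀ a β → + (a * β * q * r) ≡ + a ℤ.* + β ℤ.* + q ℤ.* + r
      pos-product a β = trans (ℤ.pos-* (a * β * q) r) (cong (ℤ._* + r)
        (trans (ℤ.pos-* (a * β) q) (cong (ℤ._* + q) (ℤ.pos-* a β))))

      QQ′ : + p ℤ∣.∣ + q ℤ.* + q′ ℤ.- 1ℤ
      QQ′ = subst (λ x → + p ℤ∣.∣ x ℤ.- 1ℤ) (ℤ.pos-* q q′) (mod⇒∣ {q * q′} {1} qq′≡1)

      RR′ : + p ℤ∣.∣ + r ℤ.* + r′ ℤ.- 1ℤ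
      RR′ = subst (λ x → + p ℤ∣.∣ x ℤ.- 1ℤ) (ℤ.pos-* r r′) (mod⇒∣ {r * r′} {1} rr′≡1)

      -- The expression is q q′ r r′ - 1, arranged as a combination of the two given multiples of p.
      unit-error : + p ℤ∣.∣ (+ q ℤ.* + q′ ℤ.- 1ℤ) ℤ.* (+ r ℤ.* + r′) ℤ.+ (+ r ℤ.* + r′ ℤ.- 1ℤ)
      unit-error = ∣m∣n⇒∣m+n (∣m⇒∣m*n (+ r ℤ.* + r′) QQ′) RR′

    -- Multiplying q′ β q r ≡ 1 by r′ and using q q′ r r′ ≡ 1 leaves β ≡ r′.
    inverse-of-q′qr : ∀ {β} → β < p → q′ * β * q * r ≡ 1 mod p → β ≡ r′
    inverse-of-q′qr {β} β<p h = residue-unique β<p r′<p (subst (+ p ℤ∣.∣_)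
      (solve 5 (λ q r q′ r′ β →
        r′ :* (q′ :* β :* q :* r :- con 1ℤ) :-
        β :* ((q :* q′ :- con 1ℤ) :* (r :* r′) :+ (r :* r′ :- con 1ℤ)) := β :- r′)
        refl (+ q) (+ r) (+ q′) (+ r′) (+ β))
      (∣m∣n⇒∣m-n
        (∣n⇒∣m*n (+ r′) (subst (λ x → + p ℤ∣.∣ x ℤ.- 1ℤ) (pos-product q′ β)
          (mod⇒∣ {q′ * β * q * r} {1} h)))
        (∣n⇒∣m*n (+ β) unit-error)))

    inverse-of-[p-q′]qr : ∀ {β} → β < p → (p ∸ q′) * β * q * r ≡ 1 mod p → β ≡ p ∸ r′
    inverse-of-[p-q′]qr {β} β<p h = residue-unique β<p
      (subst (p ∸ r′ <_) (m∸n+n≡m (<⇒≤ r′<p)) (m<m+n (p ∸ r′) 0<r′))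
      (subst (λ x → + p ℤ∣.∣ + β ℤ.- x) (sym (+∸ (<⇒≤ r′<p))) (subst (+ p ℤ∣.∣_)
        -- The multiple of p removes the p inside p - q′ and contributes the -p of β - (p - r′); the
        -- rest is the argument for q′ with the sign reversed.
        (solve 6 (λ p q r q′ r′ β →
          (r′ :* β :* q :* r :- con 1ℤ) :* p
            :- (r′ :* ((p :- q′) :* β :* q :* r :- con 1ℤ)
              :+ β :* ((q :* q′ :- con 1ℤ) :* (r :* r′) :+ (r :* r′ :- con 1ℤ))) := β :- (p :- r′))
          refl (+ p) (+ q) (+ r) (+ q′) (+ r′) (+ β))
        (∣m∣n⇒∣m-n (∣n⇒∣m*n (+ r′ ℤ.* + β ℤ.* + q ℤ.* + r ℤ.- 1ℤ) ∣-refl)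
          (∣m∣n⇒∣m+n
            (∣n⇒∣m*n (+ r′) (subst (λ x → + p ℤ∣.∣ x ℤ.* + β ℤ.* + q ℤ.* + r ℤ.- 1ℤ) (+∸ (<⇒≤ q′<p))
              (subst (λ x → + p ℤ∣.∣ x ℤ.- 1ℤ) (pos-product (p ∸ q′) β)
                (mod⇒∣ {(p ∸ q′) * β * q * r} {1} h))))
            (∣n⇒∣m*n (+ β) unit-error)))))

    -- α is q′ or p - q′, which makes β equal to r′ or p - r′ respectively; the distance does not
    -- see this sign.
    distance-β : ∀ {α β} → α ≡ distance p q′ → β < p → α * β * q * r ≡ 1 mod p →
      distance p β ≡ distance p r′
    distance-β {α} {β} α≡ β<p h with ≤-total q′ (p ∸ q′)
    ... | inj₁ le = cong (distance p) (inverse-of-q′qr β<p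
      (subst (λ a → a * β * q * r ≡ 1 mod p) (trans α≡ (m≤n⇒m⊓n≡m le)) h))
    ... | inj₂ ge = trans (cong (distance p) (inverse-of-[p-q′]qr β<p
      (subst (λ a → a * β * q * r ≡ 1 mod p) (trans α≡ (m≥n⇒m⊓n≡n ge)) h))) (distance-∸ (<⇒≤ r′<p))

  module _ {p q r q′ r′ : ℕ} (0<q′ : 0 < q′) (q′<p : q′ < p) (qq′≡1 : q * q′ ≡ 1 mod p)
    (0<r′ : 0 < r′) (r′<p : r′ < p) (rr′≡1 : r * r′ ≡ 1 mod p) where

    α-is-smaller : q′ ⊓ r′ ⊓ (p ∸ q′) ⊓ (p ∸ r′) ≡ distance p q′ ⊓ distance p r′
    α-is-smaller = begin
      q′ ⊓ r′ ⊓ (p ∸ q′) ⊓ (p ∸ r′)    ≡⟨ cong (_⊓ (p ∸ r′)) (⊓-assoc q′ r′ (p ∸ q′)) ⟩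
      q′ ⊓ (r′ ⊓ (p ∸ q′)) ⊓ (p ∸ r′)  ≡⟨ cong (λ x → q′ ⊓ x ⊓ (p ∸ r′)) (⊓-comm r′ (p ∸ q′)) ⟩
      q′ ⊓ ((p ∸ q′) ⊓ r′) ⊓ (p ∸ r′)  ≡⟨ cong (_⊓ (p ∸ r′)) (⊓-assoc q′ (p ∸ q′) r′) ⟨
      q′ ⊓ (p ∸ q′) ⊓ r′ ⊓ (p ∸ r′)    ≡⟨ ⊓-assoc (q′ ⊓ (p ∸ q′)) r′ (p ∸ r′) ⟩
      distance p q′ ⊓ distance p r′    ∎
      where open ≡-Reasoning

    -- α is the distance of one of the two inverses, and `distance-β` then gives β* as the distance
    -- of the other, hence the larger. The second case exchanges q and r.
    β*-is-larger : ∀ {β} → β < p →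
      (distance p q′ ⊓ distance p r′) * β * q * r ≡ 1 mod p →
      distance p β ≡ distance p q′ ⊔ distance p r′
    β*-is-larger {β} β<p h with ≤-total (distance p q′) (distance p r′)
    ... | inj₁ le = trans
      (distance-β {p} {q} {r} {q′} {r′} q′<p qq′≡1 0<r′ r′<p rr′≡1 (m≤n⇒m⊓n≡m le) β<p h)
      (sym (m≤n⇒m⊔n≡n le))
    ... | inj₂ ge = trans
      (distance-β {p} {r} {q} {r′} {q′} r′<p rr′≡1 0<q′ q′<p qq′≡1
        (m≥n⇒m⊓n≡n ge) β<p (subst (_≡ 1 mod p) swap h))
      (sym (m≥n⇒m⊔n≡m ge))
      where
      α = distance p q′ ⊓ distance p r′
      swap : α * β * q * r ≡ α * β * r * q
      swap = trans (*-assoc (α * β) q r)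
        (trans (cong (α * β *_) (*-comm q r)) (sym (*-assoc (α * β) r q)))

  -- The maximum is found constructively by a finite search, since all values from N on are 0.
  maximum : ∀ (f : ℕ → ℕ) N → (∀ n → N ≤ n → f n ≡ 0) → ∃ (IsMaximum f)
  maximum f zero    vanishing =
    0 , (0 , vanishing 0 z≤n) , λ n → ≤-reflexive (vanishing n z≤n)
  maximum f (suc N) vanishing = extend (up-to N)
    where
    up-to : ∀ N → ∃ λ n → ∀ m → m ≤ N → f m ≤ f n
    up-to zero    = 0 , λ where zero z≤n → ≤-refl
    up-to (suc N) with up-to N
    ... | n , max with ≤-total (f n) (f (suc N))
    ...   | inj₁ le = suc N , λ m m≤1+N → cases m (m≤n⇒m<n∨m≡n m≤1+N)
      where
      cases : ∀ m → m < suc N ⊎ m ≡ suc N → f m ≤ f (suc N)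
      cases m (inj₁ (s≤s m≤N)) = ≤-trans (max m m≤N) le
      cases m (inj₂ refl)      = ≤-refl
    ...   | inj₂ ge = n , λ m m≤1+N → cases m (m≤n⇒m<n∨m≡n m≤1+N)
      where
      cases : ∀ m → m < suc N ⊎ m ≡ suc N → f m ≤ f n
      cases m (inj₁ (s≤s m≤N)) = max m m≤N
      cases m (inj₂ refl)      = ge
    extend : (∃ λ n → ∀ m → m ≤ N → f m ≤ f n) → ∃ (IsMaximum f)
    extend (n , max) = f n , (n , refl) , λ m → bounded m (≤-total m N)
      where
      bounded : ∀ m → m ≤ N ⊎ N ≤ m → f m ≤ f n
      bounded m (inj₁ m≤N) = max m m≤N
      bounded m (inj₂ N≤m) with m≤n⇒m<n∨m≡n N≤m
      ... | inj₁ N<m  = ≤-trans (≤-reflexive (vanishing m N<m)) z≤n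
      ... | inj₂ refl = max m ≤-refl

-- Identification of the coefficients of the cyclotomic polynomial with the bracket sums.

module CyclotomicCoefficients where
  open ResidueCounting
  open Families using (distance; bound)
  open LatticeCoordinates using (Inverses; module Lattice)
  open CoefficientSums using (Δ; module Bounded)
  open GeneratingFunctions using (module Generating)
  open LaurentSequences using (module Sequences)
  open Permutations using (module InclusionExclusion)
  open Parameters
  open import Algebra.Apartness.Bundles using (HeytingField; HeytingCommutativeRing)
  open import Algebra.Bundles using (CommutativeRing)
  import Algebra.Properties.CommutativeSemiring.Exp as Exp
  import Algebra.Properties.Ring as RingProperties
  import Algebra.Properties.Semiring.Mult as Mult
  open import Data.Integer.Base as ℤ using (ℤ; +_; -[1+_]; 1ℤ; 0ℤ)
  import Data.Integer.Properties as ℤ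
  open import Data.Integer.Solver using (module +-*-Solver)
  open import Data.List.Base using (List; []; _++_; length; upTo)
  open import Data.List.Membership.Propositional using (lose)
  open import Data.List.Membership.Propositional.Properties using (∈-upTo⁺)
  open import Data.List.Properties using (foldr-++; filter-notAll; length-upTo; ++-identityʳ)
  open import Data.List.Relation.Binary.Permutation.Propositional.Properties using (++-comm)
  open import Data.Nat.Base as ℕ using (ℕ; zero; suc)
  import Data.Nat.Properties as ℕ
  open import Data.Nat.Primality using (Prime; prime⇒nonZero)
  open import Data.Product.Base using (_×_; proj₁; proj₂)
  import Relation.Binary.Reasoning.Setoid as SetoidReasoning
  open import Relation.Binary.PropositionalEquality as ≡ using (_≡_; _≢_)
  open import Relation.Nullary.Decidable using (yes; no)
  open import Relation.Nullary.Negation using (contradiction)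

  Δ-negative : ∀ d {f} → (∀ m → m ℤ.< 0ℤ → f m ≡ 0ℤ) → ∀ m → m ℤ.< 0ℤ → Δ (+ d) f m ≡ 0ℤ
  Δ-negative d f-negative m m<0 = ≡.cong₂ ℤ._-_
    (f-negative (m ℤ.- + d) (ℤ.≤-<-trans (ℤ.i≤j⇒i-k≤j (+ d) ℤ.≤-refl) m<0)) (f-negative m m<0)

  module Coefficients {p q r q′ r′} (inv : Inverses p q r q′ r′) where
    open Lattice inv using (P; Q; R)
    open Bounded inv using (χ; χ-negative)

    -- The quotient (x^p - 1)/(x - 1) is written out as 1 + x + ... + x^(p-1), so `a` is the series
    -- of (x^p - 1)(x^q - 1)(x^r - 1)/(x - 1) times that of `χ`.
    κ a : ℤ → ℤ
    κ = Δ Q (Δ R χ)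
    a m = sum< p (λ j → κ (m ℤ.- + j))

    a-negative : ∀ m → m ℤ.< 0ℤ → a m ≡ 0ℤ
    a-negative m m<0 = ≡.trans
      (sum<-cong p λ j → Δ-negative q (Δ-negative r χ-negative) (m ℤ.- + j)
        (ℤ.≤-<-trans (ℤ.i≤j⇒i-k≤j (+ j) ℤ.≤-refl) m<0))
      (sum<-zero p)

    -- This is (x - 1)(1 + x + ... + x^(k-1)) = x^k - 1 acting on `f`.
    telescope : ∀ f k m →
      sum< k (λ j → f (m ℤ.- 1ℤ ℤ.- + j)) ℤ.- sum< k (λ j → f (m ℤ.- + j)) ≡ Δ (+ k) f m
    telescope f zero    m = ≡.sym (≡.trans
      (≡.cong (λ i → f i ℤ.- f m) (ℤ.+-identityʳ m)) (ℤ.+-inverseʳ (f m)))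
    telescope f (suc k) m = begin
      (s ℤ.+ f (m ℤ.- 1ℤ ℤ.- + k)) ℤ.- (s′ ℤ.+ f (m ℤ.- + k))
        ≡⟨ solve 4 (λ a b c d → a :+ b :- (c :+ d) := a :- c :+ (b :- d)) ≡.refl
             s (f (m ℤ.- 1ℤ ℤ.- + k)) s′ (f (m ℤ.- + k)) ⟩
      (s ℤ.- s′) ℤ.+ (f (m ℤ.- 1ℤ ℤ.- + k) ℤ.- f (m ℤ.- + k))
        ≡⟨ ≡.cong₂ (λ x i → x ℤ.+ (f i ℤ.- f (m ℤ.- + k))) (telescope f k m)
             (solve 2 (λ m k → m :- con 1ℤ :- k := m :- (con 1ℤ :+ k)) ≡.refl m (+ k)) ⟩
      (f (m ℤ.- + k) ℤ.- f m) ℤ.+ (f (m ℤ.- + suc k) ℤ.- f (m ℤ.- + k))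
        ≡⟨ solve 3 (λ a b c → a :- b :+ (c :- a) := c :- b) ≡.refl
             (f (m ℤ.- + k)) (f m) (f (m ℤ.- + suc k)) ⟩
      f (m ℤ.- + suc k) ℤ.- f m ∎
      where
      open ≡.≡-Reasoning
      open +-*-Solver
      s s′ : ℤ
      s  = sum< k (λ j → f (m ℤ.- 1ℤ ℤ.- + j))
      s′ = sum< k (λ j → f (m ℤ.- + j))

    Δa : ∀ m → Δ 1ℤ a m ≡ Δ P κ m
    Δa = telescope κ p

  module Transfer {ℓ₀ ℓ₁ ℓ₂} (K : HeytingField ℓ₀ ℓ₁ ℓ₂) where
    open Cyclotomic K
    open HeytingCommutativeRing (HeytingField.heytingCommutativeRing K) using (commutativeRing)
    open CommutativeRing commutativeRing
    open RingProperties ring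
    open Exp commutativeSemiring
    open Mult semiring using (×-homo-+) renaming (_×_ to _·_)
    open Sequences K
    open SetoidReasoning setoid

    fromℤ-⊖ : ∀ m n → fromℤ (m ℤ.⊖ n) ≈ m · 1# - n · 1#
    fromℤ-⊖ zero    zero    = sym (-‿inverseʳ 0#)
    fromℤ-⊖ zero    (suc n) = sym (+-identityˡ _)
    fromℤ-⊖ (suc m) zero    = sym (trans (+-congˡ -0#≈0#) (+-identityʳ _))
    fromℤ-⊖ (suc m) (suc n) = begin
      fromℤ (suc m ℤ.⊖ suc n)            ≡⟨ ≡.cong fromℤ (ℤ.[1+m]⊖[1+n]≡m⊖n m n) ⟩
      fromℤ (m ℤ.⊖ n)                    ≈⟨ fromℤ-⊖ m n ⟩
      m · 1# - n · 1#                    ≈⟨ +-congʳ (+-identityˡ (m · 1#)) ⟨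
      0# + m · 1# - n · 1#               ≈⟨ +-congʳ (+-congʳ (-‿inverseʳ 1#)) ⟨
      1# - 1# + m · 1# - n · 1#          ≈⟨ +-congʳ (trans (+-assoc 1# (- 1#) _)
                                               (trans (+-congˡ (+-comm (- 1#) _))
                                                 (sym (+-assoc 1# _ (- 1#))))) ⟩
      1# + m · 1# - 1# - n · 1#          ≈⟨ +-assoc _ (- 1#) _ ⟩
      1# + m · 1# + (- 1# - n · 1#)      ≈⟨ +-congˡ (-‿+-comm 1# (n · 1#)) ⟩
      1# + m · 1# - (1# + n · 1#)        ∎

    fromℤ-- : ∀ i j → fromℤ (i ℤ.- j) ≈ fromℤ i - fromℤ j
    fromℤ-- (+ m) (+ n) = trans (reflexive (≡.cong fromℤ (ℤ.m-n≡m⊖n m n))) (fromℤ-⊖ m n)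
    fromℤ-- (+ m) -[1+ n ] = trans (×-homo-+ 1# m (suc n)) (+-congˡ (sym (-‿involutive _)))
    fromℤ-- -[1+ m ] (+ zero) = sym (trans (+-congˡ -0#≈0#) (+-identityʳ _))
    fromℤ-- -[1+ m ] (+ suc n) = begin
      - (suc (suc (m ℕ.+ n)) · 1#)     ≡⟨ ≡.cong (λ k → - (suc k · 1#)) (ℕ.+-suc m n) ⟨
      - (suc (m ℕ.+ suc n) · 1#)       ≈⟨ -‿cong (×-homo-+ 1# (suc m) (suc n)) ⟩
      - (suc m · 1# + suc n · 1#)      ≈⟨ -‿+-comm (suc m · 1#) (suc n · 1#) ⟨
      - (suc m · 1#) - suc n · 1#      ∎
    fromℤ-- -[1+ m ] -[1+ n ] = begin
      fromℤ (suc n ℤ.⊖ suc m)          ≈⟨ fromℤ-⊖ (suc n) (suc m) ⟩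
      suc n · 1# - suc m · 1#          ≈⟨ +-comm _ _ ⟩
      - (suc m · 1#) + suc n · 1#      ≈⟨ +-congˡ (-‿involutive _) ⟨
      - (suc m · 1#) - - (suc n · 1#)  ∎

    D : ℤ → Sequence → Sequence
    D d = T d (- 1#)

    fromℤ-Δ : ∀ d f m → fromℤ (Δ d f m) ≈ D d (λ i → fromℤ (f i)) m
    fromℤ-Δ d f m = trans (fromℤ-- (f (m ℤ.- d)) (f m)) (+-congˡ (sym (-1*x≈-x _)))

    D-≋ : ∀ d {f g} → f ≋ g → D d f ≋ D d g
    D-≋ d = T-≋ d (- 1#)

    D-comm : ∀ d e f → D d (D e f) ≋ D e (D d f)
    D-comm d e = T-comm d e (- 1#) (- 1#)

    fromℤ-Δ³ : ∀ d e g f m →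
      fromℤ (Δ d (Δ e (Δ g f)) m) ≈ D d (D e (D g (λ i → fromℤ (f i)))) m
    fromℤ-Δ³ d e g f m = trans (fromℤ-Δ d (Δ e (Δ g f)) m)
      (D-≋ d (λ i → trans (fromℤ-Δ e (Δ g f) i) (D-≋ e (fromℤ-Δ g f) i)) m)

    D-below : ∀ N d {f g} → (∀ m → m ℤ.< N → f m ≈ g m) → ∀ m → m ℤ.< N → D (+ d) f m ≈ D (+ d) g m
    D-below N d f≈g m m<N = +-cong
      (f≈g (m ℤ.- + d) (ℤ.≤-<-trans (ℤ.i≤j⇒i-k≤j (+ d) ℤ.≤-refl) m<N)) (*-congˡ (f≈g m m<N))

    D-comm³ : ∀ d e g h f → D d (D e (D g (D h f))) ≋ D e (D g (D h (D d f)))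
    D-comm³ d e g h f m = trans (D-comm d e (D g (D h f)) m)
      (D-≋ e (λ i → trans (D-comm d g (D h f) i) (D-≋ g (D-comm d h f) i)) m)

    fromℤ-δ : ∀ m → fromℤ (GeneratingFunctions.δ m) ≈ δ m
    fromℤ-δ (+ zero)  = +-identityʳ 1#
    fromℤ-δ (+ suc _) = refl
    fromℤ-δ -[1+ _ ]  = refl

    fromℤ-neg : ∀ i → fromℤ (ℤ.- i) ≈ - 1# * fromℤ i
    fromℤ-neg i = begin
      fromℤ (ℤ.- i)         ≡⟨ ≡.cong fromℤ (ℤ.+-identityˡ (ℤ.- i)) ⟨
      fromℤ (0ℤ ℤ.- i)      ≈⟨ fromℤ-- 0ℤ i ⟩
      0# - fromℤ i          ≈⟨ +-identityˡ _ ⟩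
      - fromℤ i             ≈⟨ -1*x≈-x _ ⟨
      - 1# * fromℤ i        ∎

    module Main {p q r : ℕ} (p-prime : Prime p) (q-prime : Prime q) (r-prime : Prime r)
      (p<q : p ℕ.< q) (p<r : p ℕ.< r) (q≢r : q ≢ r)
      (ζ : Carrier) (ζ-primitive : IsPrimitiveRoot (p ℕ.* q ℕ.* r) ζ)
      {q′ r′ : ℕ} (inv : Inverses p q r q′ r′) where

      open InclusionExclusion p-prime q-prime r-prime (ℕ.<⇒≢ p<q) (ℕ.<⇒≢ p<r) q≢r
        using (N; unit?; inclusion–exclusion)
      open Roots ζ
      open Lattice inv using (P; Q; R)
      open Bounded inv using (χ)
      open Generating inv using (Δ³χ)
      open Coefficients inv

      private
        instance
          p≢0 = prime⇒nonZero p-prime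
          q≢0 = prime⇒nonZero q-prime
          r≢0 = prime⇒nonZero r-prime
          pq≢0 = ℕ.m*n≢0 p q
          pr≢0 = ℕ.m*n≢0 p r
          qr≢0 = ℕ.m*n≢0 q r
          N≢0 = ℕ.m*n≢0 (p ℕ.* q) r

        -- As d n = N, the element ζ^d has order n and its powers contribute x^n - 1. The block is
        -- moved to the end, where it acts on `δ` and `∏-multiples` applies; the resulting operator
        -- commutes back to the front.
        peel : ∀ d n .{{d≢0 : ℕ.NonZero d}} .{{_ : ℕ.NonZero n}} → d ℕ.* n ≡ N → ∀ ks →
          ∏ (multiples d n ++ ks) δ ≋ D (+ n) (∏ ks δ)
        peel d (suc n) {{d≢0}} dn≡N ks m = begin
          ∏ (multiples d (suc n) ++ ks) δ m
            ≈⟨ ∏-↭ (++-comm (multiples d (suc n)) ks) δ m ⟩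
          ∏ (ks ++ multiples d (suc n)) δ m
            ≡⟨ ≡.cong (λ f → f m) (foldr-++ factor δ ks (multiples d (suc n))) ⟩
          ∏ ks (∏ (multiples d (suc n)) δ) m
            ≈⟨ ∏-cong ks (∏-multiples d n
                 (trans (^-congʳ ζ dn≡N) (proj₁ ζ-primitive))
                 (λ k 0<k k<n → proj₂ ζ-primitive (d ℕ.* k)
                   (ℕ.>-nonZero⁻¹ (d ℕ.* k) {{ℕ.m*n≢0 d k {{d≢0}} {{ℕ.>-nonZero 0<k}}}})
                   (≡.subst (d ℕ.* k ℕ.<_) dn≡N (ℕ.*-monoʳ-< d k<n)))) m ⟩
          ∏ ks (D (+ suc n) δ) m
            ≈⟨ ∏-T ks (+ suc n) (- 1#) δ m ⟩
          D (+ suc n) (∏ ks δ) m ∎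

        c : Sequence
        c = ∏ (units N) δ

        A X : Sequence
        A m = fromℤ (a m)
        X m = fromℤ (χ m)

        p[qr] : p ℕ.* (q ℕ.* r) ≡ N
        p[qr] = ≡.sym (ℕ.*-assoc p q r)
        q[pr] : q ℕ.* (p ℕ.* r) ≡ N
        q[pr] = ≡.trans (≡.sym (ℕ.*-assoc q p r)) (≡.cong (ℕ._* r) (ℕ.*-comm q p))

        -- The product formula with denominators cleared. Writing all factors as x^d - 1 costs no
        -- sign, there being four on each side.
        c-equation : D (+ (q ℕ.* r)) (D (+ (p ℕ.* r)) (D (+ (p ℕ.* q)) (D 1ℤ c))) ≋
          D P (D Q (D R (D (+ N) δ)))
        c-equation m = begin
          D qr (D pr (D pq (D 1ℤ c))) m
            ≡⟨ ≡.cong (λ ks → D qr (D pr (D pq (D 1ℤ (∏ ks δ)))) m) (++-identityʳ (units N)) ⟨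
          D qr (D pr (D pq (D 1ℤ (∏ U₀ δ)))) m
            ≈⟨ D-≋ qr (D-≋ pr (D-≋ pq (peel N 1 (ℕ.*-identityʳ N) U₀))) m ⟨
          D qr (D pr (D pq (∏ U₁ δ))) m
            ≈⟨ D-≋ qr (D-≋ pr (peel r (p ℕ.* q) (ℕ.*-comm r (p ℕ.* q)) U₁)) m ⟨
          D qr (D pr (∏ U₂ δ)) m
            ≈⟨ D-≋ qr (peel q (p ℕ.* r) q[pr] U₂) m ⟨
          D qr (∏ U₃ δ) m
            ≈⟨ peel p (q ℕ.* r) p[qr] U₃ m ⟨
          ∏ (multiples p (q ℕ.* r) ++ U₃) δ m
            ≈⟨ ∏-↭ inclusion–exclusion δ m ⟩
          ∏ (multiples (q ℕ.* r) p ++ V₂) δ m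
            ≈⟨ peel (q ℕ.* r) p (≡.trans (ℕ.*-comm (q ℕ.* r) p) p[qr]) V₂ m ⟩
          D P (∏ V₂ δ) m
            ≈⟨ D-≋ P (peel (p ℕ.* r) q (≡.trans (ℕ.*-comm (p ℕ.* r) q) q[pr]) V₁) m ⟩
          D P (D Q (∏ V₁ δ)) m
            ≈⟨ D-≋ P (D-≋ Q (peel (p ℕ.* q) r ≡.refl V₀)) m ⟩
          D P (D Q (D R (∏ V₀ δ))) m
            ≈⟨ D-≋ P (D-≋ Q (D-≋ R (peel 1 N (ℕ.*-identityˡ N) []))) m ⟩
          D P (D Q (D R (D (+ N) δ))) m ∎
          where
          qr pr pq : ℤ
          qr = + (q ℕ.* r)
          pr = + (p ℕ.* r)
          pq = + (p ℕ.* q)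
          U₀ U₁ U₂ U₃ V₀ V₁ V₂ : List ℕ
          U₀ = units N ++ []
          U₁ = multiples N 1 ++ U₀
          U₂ = multiples r (p ℕ.* q) ++ U₁
          U₃ = multiples q (p ℕ.* r) ++ U₂
          V₀ = multiples 1 N ++ []
          V₁ = multiples (p ℕ.* q) r ++ V₀
          V₂ = multiples (p ℕ.* r) q ++ V₁

        a-step : D 1ℤ A ≋ D P (D Q (D R X))
        a-step m = begin
          D 1ℤ A m             ≈⟨ fromℤ-Δ 1ℤ a m ⟨
          fromℤ (Δ 1ℤ a m)     ≡⟨ ≡.cong fromℤ (Δa m) ⟩
          fromℤ (Δ P κ m)      ≈⟨ fromℤ-Δ³ P Q R χ m ⟩
          D P (D Q (D R X)) m  ∎

        -- Below N the series -1 coincides with x^N - 1, since `δ` shifted by N vanishes there. This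
        -- supplies the factor x^N - 1 of the product formula.
        D³X : ∀ m → m ℤ.< + N →
          D (+ (q ℕ.* r)) (D (+ (p ℕ.* r)) (D (+ (p ℕ.* q)) X)) m ≈ D (+ N) δ m
        D³X m m<N = begin
          D (+ (q ℕ.* r)) (D (+ (p ℕ.* r)) (D (+ (p ℕ.* q)) X)) m
            ≈⟨ fromℤ-Δ³ (+ (q ℕ.* r)) (+ (p ℕ.* r)) (+ (p ℕ.* q)) χ m ⟨
          fromℤ (Δ (+ (q ℕ.* r)) (Δ (+ (p ℕ.* r)) (Δ (+ (p ℕ.* q)) χ)) m)
            ≡⟨ ≡.cong fromℤ Δ³χ′ ⟩
          fromℤ (ℤ.- GeneratingFunctions.δ m)
            ≈⟨ trans (fromℤ-neg (GeneratingFunctions.δ m)) (*-congˡ (fromℤ-δ m)) ⟩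
          - 1# * δ m
            ≈⟨ +-identityˡ _ ⟨
          0# + - 1# * δ m
            ≈⟨ +-congʳ (δ-negative (m ℤ.- + N) m-N<0) ⟨
          D (+ N) δ m ∎
          where
          pos-N : + N ≡ P ℤ.* Q ℤ.* R
          pos-N = ≡.trans (ℤ.pos-* (p ℕ.* q) r) (≡.cong (ℤ._* R) (ℤ.pos-* p q))
          Δ³χ′ : Δ (+ (q ℕ.* r)) (Δ (+ (p ℕ.* r)) (Δ (+ (p ℕ.* q)) χ)) m ≡ ℤ.- GeneratingFunctions.δ m
          Δ³χ′ rewrite ℤ.pos-* q r | ℤ.pos-* p r | ℤ.pos-* p q =
            Δ³χ m (≡.subst (m ℤ.<_) pos-N m<N)
          m-N<0 : m ℤ.- + N ℤ.< 0ℤ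
          m-N<0 = ≡.subst (m ℤ.- + N ℤ.<_) (ℤ.+-inverseʳ (+ N)) (ℤ.+-monoˡ-< (ℤ.- + N) m<N)
          δ-negative : ∀ m → m ℤ.< 0ℤ → δ m ≈ 0#
          δ-negative -[1+ _ ] _ = refl
          δ-negative (+ _) (ℤ.+<+ ())

        a-equation : ∀ m → m ℤ.< + N →
          D (+ (q ℕ.* r)) (D (+ (p ℕ.* r)) (D (+ (p ℕ.* q)) (D 1ℤ A))) m ≈
          D P (D Q (D R (D (+ N) δ))) m
        a-equation m m<N = begin
          D qr (D pr (D pq (D 1ℤ A))) m
            ≈⟨ D-≋ qr (D-≋ pr (D-≋ pq a-step)) m ⟩
          D qr (D pr (D pq (D P (D Q (D R X))))) m
            ≈⟨ D-≋ qr (D-≋ pr (D-comm³ pq P Q R X)) m ⟩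
          D qr (D pr (D P (D Q (D R (D pq X))))) m
            ≈⟨ D-≋ qr (D-comm³ pr P Q R (D pq X)) m ⟩
          D qr (D P (D Q (D R (D pr (D pq X))))) m
            ≈⟨ D-comm³ qr P Q R (D pr (D pq X)) m ⟩
          D P (D Q (D R (D qr (D pr (D pq X))))) m
            ≈⟨ D-below (+ N) p (D-below (+ N) q (D-below (+ N) r D³X)) m m<N ⟩
          D P (D Q (D R (D (+ N) δ))) m ∎
          where
          qr pr pq : ℤ
          qr = + (q ℕ.* r)
          pr = + (p ℕ.* r)
          pq = + (p ℕ.* q)

        D-causal : ∀ d f → Causal f → Causal (D (+ d) f)
        D-causal d f = T-causal d (- 1#) {f}

        D-injective : ∀ d .{{_ : ℕ.NonZero d}} f g → Causal f → Causal g →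
          (∀ m → m ℤ.< + N → D (+ d) f m ≈ D (+ d) g m) → ∀ m → m ℤ.< + N → f m ≈ g m
        D-injective (suc d) f g = T-injective d N {f} {g}

        A-causal : Causal A
        A-causal n = reflexive (≡.cong fromℤ (a-negative -[1+ n ] ℤ.-<+))

        -- Both sequences solve the cleared equation below N. The operators for qr, pr, pq and 1 are
        -- cancelled from the outside in; each cancellation keeps the range m < N.
        c≈A : ∀ m → m ℤ.< + N → c m ≈ A m
        c≈A =
          D-injective 1 c A c₀ A₀
            (D-injective (p ℕ.* q) (D 1ℤ c) (D 1ℤ A) c₁ A₁
              (D-injective (p ℕ.* r) (D pq (D 1ℤ c)) (D pq (D 1ℤ A)) c₂ A₂
                (D-injective (q ℕ.* r) (D pr (D pq (D 1ℤ c))) (D pr (D pq (D 1ℤ A))) c₃ A₃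
                  (λ m m<N → trans (c-equation m) (sym (a-equation m m<N))))))
          where
          pr pq : ℤ
          pr = + (p ℕ.* r)
          pq = + (p ℕ.* q)
          c₀ = ∏-causal (units N)
          c₁ = D-causal 1 c c₀
          c₂ = D-causal (p ℕ.* q) (D 1ℤ c) c₁
          c₃ = D-causal (p ℕ.* r) (D pq (D 1ℤ c)) c₂
          A₀ = A-causal
          A₁ = D-causal 1 A A₀
          A₂ = D-causal (p ℕ.* q) (D 1ℤ A) A₁
          A₃ = D-causal (p ℕ.* r) (D pq (D 1ℤ A)) A₂

        -- The exponent 0 is filtered out, so the degree is below N and every coefficient from N on
        -- vanishes.
        length-units : length (units N) ℕ.< N
        length-units = ≡.subst (length (units N) ℕ.<_) (length-upTo N)
          (filter-notAll unit? (upTo N) (lose (∈-upTo⁺ (ℕ.>-nonZero⁻¹ N)) (λ ())))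

      -- Cut off at N, because `a` is known to agree with the product only below N; beyond, the
      -- degree gives 0.
      coefficient : ℕ → ℤ
      coefficient n with n ℕ.<? N
      ... | yes _ = a (+ n)
      ... | no _  = 0ℤ

      coefficient-correct : HasIntegerCoefficients (cyclotomic N ζ) coefficient
      coefficient-correct n with n ℕ.<? N
      ... | yes n<N = trans (⟦productᴾ⟧ (units N) (+ n)) (c≈A (+ n) (ℤ.+<+ n<N))
      ... | no n≮N  = trans (⟦productᴾ⟧ (units N) (+ n))
        (∏-degree (units N) (ℕ.<-≤-trans length-units (ℕ.≮⇒≥ n≮N)))

      coefficient-bounded : q′ ℕ.≤ p → r′ ℕ.≤ p → ∀ n →
        ℤ.∣ coefficient n ∣ ℕ.≤ bound p (distance p q′) (distance p r′)
      coefficient-bounded q′≤p r′≤p n with n ℕ.<? N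
      ... | yes n<N = Bounded.sum-bounded inv n n<N q′≤p r′≤p
      ... | no _    = ℕ.z≤n

      coefficient-vanishes : ∀ n → N ℕ.≤ n → ℤ.∣ coefficient n ∣ ≡ 0
      coefficient-vanishes n N≤n with n ℕ.<? N
      ... | yes n<N = contradiction N≤n (ℕ.<⇒≱ n<N)
      ... | no _    = ≡.refl

-- The bound in terms of α and β*.

open Parameters
open Permutations
open CyclotomicCoefficients
open Families
open import Algebra.Apartness.Bundles using (HeytingField)
open import Data.Integer.Base using (ℤ; ∣_∣)
open import Data.Nat.Base using (ℕ; _+_; _*_; _∸_; _⊓_; _⊔_; _≤_; _<_; nonTrivial⇒n>1)
open import Data.Nat.Properties using (<⇒≤)
open import Data.Nat.Primality using (Prime; prime⇒nonTrivial)
open import Data.Product.Base using (_×_; ∃; _,_; proj₁; proj₂)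
open import Relation.Binary.PropositionalEquality using (_≡_; _≢_; sym; cong₂; subst; subst₂)

theorem2 : ∀ {c ℓ₁ ℓ₂} (K : HeytingField c ℓ₁ ℓ₂) → let open Cyclotomic K in
    CharacteristicZero →
    ∀ (p q r : ℕ) → Prime p → Prime q → Prime r →
    p < q → p < r → q ≢ r →
    ∀ (ζ : HeytingField.Carrier K) → IsPrimitiveRoot (p * q * r) ζ →
    ∀ (q' r' : ℕ) →
    0 < q' → q' < p → q * q' ≡ 1 mod p →
    0 < r' → r' < p → r * r' ≡ 1 mod p →
    let α = q' ⊓ r' ⊓ (p ∸ q') ⊓ (p ∸ r') in
    ∀ (β : ℕ) → 0 < β → β < p → α * β * q * r ≡ 1 mod p →
    let β* = β ⊓ (p ∸ β) in
    ∃ λ (a : ℕ → ℤ) → ∃ λ (A : ℕ) →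
    HasIntegerCoefficients (cyclotomic (p * q * r) ζ) a ×
    IsMaximum (λ n → ∣ a n ∣) A ×
    A ≤ (2 * α + β*) ⊓ (p ∸ β*)
theorem2 K _ p q r p-prime q-prime r-prime p<q p<r q≢r ζ ζ-primitive
  q' r' 0<q' q'<p qq'≡1 0<r' r'<p rr'≡1 β _ β<p αβqr≡1 =
  coefficient , proj₁ max , coefficient-correct , proj₂ max , max≤
  where
  open Transfer.Main K p-prime q-prime r-prime p<q p<r q≢r ζ ζ-primitive
    (inverses (nonTrivial⇒n>1 p {{prime⇒nonTrivial p-prime}}) p<q p<r
      (distinct-primes-coprime q-prime r-prime q≢r) 0<q' q'<p qq'≡1 0<r' r'<p rr'≡1)

  max : ∃ (IsMaximum (λ n → ∣ coefficient n ∣))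
  max = maximum (λ n → ∣ coefficient n ∣) (p * q * r) coefficient-vanishes

  α-eq : q' ⊓ r' ⊓ (p ∸ q') ⊓ (p ∸ r') ≡ distance p q' ⊓ distance p r'
  α-eq = α-is-smaller {p} {q} {r} 0<q' q'<p qq'≡1 0<r' r'<p rr'≡1

  β*-eq : β ⊓ (p ∸ β) ≡ distance p q' ⊔ distance p r'
  β*-eq = β*-is-larger {p} {q} {r} 0<q' q'<p qq'≡1 0<r' r'<p rr'≡1 β<p
    (subst (λ α → α * β * q * r ≡ 1 mod p) α-eq αβqr≡1)

  max≤ : proj₁ max ≤
    (2 * (q' ⊓ r' ⊓ (p ∸ q') ⊓ (p ∸ r')) + β ⊓ (p ∸ β)) ⊓ (p ∸ (β ⊓ (p ∸ β)))
  -- The maximum is attained at some `n`, so the pointwise bound there bounds it; the bound itself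
  -- is symmetric in the two distances, whose minimum is α and whose maximum is β*.
  max≤ with ((n , eq) , _) ← proj₂ max =
    subst₂ _≤_ eq (sym (cong₂ (λ α β* → (2 * α + β*) ⊓ (p ∸ β*)) α-eq β*-eq))
      (coefficient-bounded (<⇒≤ q'<p) (<⇒≤ r'<p) n)
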